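{- Let $G$ and $H$ be finite connected graphs such that $\mathrm{drm}(G)\neq\mathrm{drm}(H)$, there is a locally injective homomorphism $G\to H$, and $H$ has no vertices of degree $1$. Then: (a) There exists a connected graph $F$ such that $G<^{LI}F<^{LI}H$, $\mathrm{drm}(F)\neq\mathrm{drm}(G)$ and $\mathrm{drm}(F)\neq\mathrm{drm}(H)$. (b) When $G$ has no vertices of degree $1$ and $H$ has at least one cycle with a vertex of degree greater than $2$, then $F$ can be chosen to have, in addition, no vertices of degree $1$ and to contain a cycle with a vertex of degree greater than $2$.
   Context: Graphs are finite, nonempty and undirected, loops allowed. $N_G(v)$ is the set of vertices adjacent to $v$ (containing $v$ iff $v$ has a loop), and the degree of $v$ is $|N_G(v)|$. Cycles have at least three distinct vertices. A graph homomorphism $f:G\to H$ is locally injective if for every $v\in V_G$ the restriction of $f$ to $N_G(v)\to N_H(f(v))$ is injective. $G\leq^{LI}H$ means there is a locally injective homomorphism $G\to H$, and $G<^{LI}H$ means $G\leq^{LI}H$ and not $H\leq^{LI}G$. An equitable partition of $G$ is a partition $B_1,\dots,B_k$ of $V_G$ such that for all $i,j$ every vertex $u\in B_i$ has the same number $m_{i,j}=|N_G(u)\cap B_j|$ of neighbours in $B_j$. Every finite graph has a unique coarsest equitable partition; its matrix $(m_{i,j})$, with blocks canonically ordered, is the degree refinement matrix $\mathrm{drm}(G)$ (so $\mathrm{drm}(G)=\mathrm{drm}(H)$ means these matrices agree up to a simultaneous permutation of rows and columns). -}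

module Defs where

open import Data.Fin using (Fin; zero; suc; inject₁; fromℕ)
open import Data.Fin.Permutation using (Permutation; _⟨$⟩ʳ_)
open import Data.Fin.Subset using (Subset; _∈_; _⊆_; _∩_; ∣_∣; Nonempty)
open import Data.Nat using (ℕ; suc; _≤_; _>_; NonZero)
open import Data.Product using (Σ-syntax; ∃-syntax; ∃!; _×_)
open import Function.Definitions using (Injective)
open import Relation.Binary.Construct.Closure.ReflexiveTransitive using (Star)
open import Relation.Binary.PropositionalEquality using (_≡_)
open import Relation.Nullary using (¬_)

-- The adjacency relation is given by neighbourhoods; v ∈ N v is a loop at v.
record Graph : Set where
  field
    order    : ℕ
    nonEmpty : NonZero order
    N        : Fin order → Subset order
    symmetric : ∀ {u v} → u ∈ N v → v ∈ N u

  Vertex : Set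
  Vertex = Fin order

  Adj : Vertex → Vertex → Set
  Adj u v = v ∈ N u

  degree : Vertex → ℕ
  degree v = ∣ N v ∣

open Graph public using (Vertex; Adj; degree)

Connected : Graph → Set
Connected G = ∀ (u v : Vertex G) → Star (Adj G) u v

NoDegreeOne : Graph → Set
NoDegreeOne G = ∀ (v : Vertex G) → ¬ (degree G v ≡ 1)

record Cycle (G : Graph) : Set where
  field
    last      : ℕ
    atLeast3  : 3 ≤ suc last
    vertex    : Fin (suc last) → Vertex G
    distinct  : Injective _≡_ _≡_ vertex
    step      : ∀ (i : Fin last) → Adj G (vertex (inject₁ i)) (vertex (suc i))
    close     : Adj G (vertex (fromℕ last)) (vertex zero)

HasCycleWithDegreeAbove2 : Graph → Set
HasCycleWithDegreeAbove2 G =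
  Σ[ c ∈ Cycle G ] ∃[ i ] degree G (Cycle.vertex c i) > 2

record LIHom (G H : Graph) : Set where
  private
    module G = Graph G
    module H = Graph H
  field
    map              : Vertex G → Vertex H
    homomorphism     : ∀ {u v} → Adj G u v → Adj H (map u) (map v)
    locallyInjective : ∀ v {x y} → x ∈ G.N v → y ∈ G.N v → map x ≡ map y → x ≡ y

infix 4 _≤LI_ _<LI_ _≈drm_

_≤LI_ : Graph → Graph → Set
G ≤LI H = LIHom G H

_<LI_ : Graph → Graph → Set
G <LI H = G ≤LI H × ¬ (H ≤LI G)

record EquitablePartition (G : Graph) : Set where
  open Graph G using (order; N)
  field
    size       : ℕ
    block      : Fin size → Subset order
    nonempty   : ∀ i → Nonempty (block i)
    exactlyOne : ∀ v → ∃! _≡_ λ i → v ∈ block i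
    matrix     : Fin size → Fin size → ℕ
    equitable  : ∀ i j {u} → u ∈ block i → ∣ N u ∩ block j ∣ ≡ matrix i j

_Refines_ : {G : Graph} → EquitablePartition G → EquitablePartition G → Set
P Refines Q = ∀ i → ∃[ j ] P.block i ⊆ Q.block j
  where
  module P = EquitablePartition P
  module Q = EquitablePartition Q

Coarsest : {G : Graph} → EquitablePartition G → Set
Coarsest {G} P = ∀ (Q : EquitablePartition G) → Q Refines P

SameMatrix : {G H : Graph} → EquitablePartition G → EquitablePartition H → Set
SameMatrix P Q =
  Σ[ π ∈ Permutation P.size Q.size ]
    (∀ i j → P.matrix i j ≡ Q.matrix (π ⟨$⟩ʳ i) (π ⟨$⟩ʳ j))
  where
  module P = EquitablePartition P
  module Q = EquitablePartition Q

-- G ≈drm H says drm(G) = drm(H).  The coarsest equitable partition of a finite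
-- graph exists and is unique up to the numbering of its blocks, so it does not
-- matter which numberings P and Q are chosen here.
_≈drm_ : Graph → Graph → Set
G ≈drm H =
  Σ[ P ∈ EquitablePartition G ] Σ[ Q ∈ EquitablePartition H ]
    Coarsest P × Coarsest Q × SameMatrix P Q

{-# OPTIONS --safe #-}

-- Walks lift injectively along a locally injective homomorphism f : G → H.  So
-- if f misses a neighbour somewhere, then for large n every vertex v of G starts
-- strictly fewer walks of length n than f v does (written G ≺ H below).  As the
-- set of these numbers is determined by the degree refinement matrix, G ≺ H
-- rules out both H ≤LI G and drm(G) = drm(H).  Conversely, if f misses no
-- neighbour, then the coarsest equitable partition of H pulls back to that of G,
-- so the hypotheses provide a neighbour y of f u missed by f.  It suffices to
-- find F with G → F → H, each map missing a neighbour.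
--
-- For (a), F is G with a pendant vertex over y attached to u.  For (b), this
-- pendant vertex is prolonged along a non-backtracking walk of H that passes
-- twice through a vertex c with three neighbours x, y, z, both times coming from
-- x and leaving to y, and then ends at z; joining its end to the second passage
-- closes a lollipop, while the first passage still misses z.  The required
-- walks exist since any two oriented edges of H are joined by a non-backtracking
-- walk.  If G is a single vertex, it is first embedded in a cycle through c.

module Submission where

open import Data.Bool.Base using (if_then_else_)
open import Data.Fin.Base using (Fin; zero; suc; toℕ; combine; inject₁; fromℕ)
open import Data.Fin.Permutation as Perm using (_⟨$⟩ʳ_; _⟨$⟩ˡ_; inverseˡ; inverseʳ)
open import Data.Fin.Permutation.Components using (transpose; transpose-inverse)
open import Data.Fin.Properties using (any?; all?; _≟_; suc-injective; pigeonhole; combine-injective)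
open import Data.Fin.Subset
  using (Subset; inside; outside; _∈_; _∩_; _-_; ⁅_⁆; ⊤; ∣_∣)
open import Data.Fin.Subset.Properties
  using (p─⊥≡p; p─q⊆p; x∈p∧x≢y⇒x∈p-y; ∈⊤; x∈⁅x⁆; x∈⁅y⁆⇒x≡y; drop-there; _∈?_; nonempty?)
open import Data.List.Base using (List; []; _∷_; _++_; filter; allFin)
import Data.List.Membership.DecPropositional as DecMembership
open import Data.List.Membership.Propositional using () renaming (_∈_ to _∈ₗ_)
open import Data.List.Membership.Propositional.Properties
  using (∈-filter⁺; ∈-filter⁻; ∈-allFin; ∈-++⁺ˡ; ∈-++⁺ʳ; ∈-++⁻)
open import Data.List.Relation.Unary.Any using (here; there)
open import Data.Nat.Base using (ℕ; zero; suc; _+_; _*_; _∸_; _≤_; _<_; z≤n; s≤s; s≤s⁻¹)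
open import Data.Nat.GeneralisedArithmetic using (iterate)
import Data.Nat.Properties as ℕ
open import Data.Nat.Properties
  using (≤-refl; ≤-trans; ≤-reflexive; ≤-antisym; <-≤-trans; ≤-<-trans; <-irrefl; +-mono-≤; +-mono-<-≤;
         m≤m+n; m<n+m; +-identityʳ; *-identityˡ; *-identityʳ; module ≤-Reasoning)
open import Data.Nat.Solver using (module +-*-Solver)
open import Data.Product.Base using (Σ-syntax; ∃-syntax; _×_; _,_; proj₁; proj₂)
open import Data.Sum.Base using (_⊎_; inj₁; inj₂)
import Data.Unit.Base as Unit
open import Data.Vec.Base using ([]; _∷_; tabulate; here; there)
open import Data.Vec.Properties using (lookup∘tabulate; []=⇒lookup; lookup⇒[]=)
open import Defs
open import Function.Base using (_∘_; id)
open import Function.Definitions using (Injective)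
open import Relation.Binary.Construct.Closure.ReflexiveTransitive as Star using (Star; ε; _◅_; _◅◅_)
import Relation.Binary.Definitions as Binary
open import Relation.Binary.PropositionalEquality
  using (_≡_; _≢_; refl; sym; trans; cong; cong₂; subst; subst₂; module ≡-Reasoning)
open import Relation.Binary.Structures using (IsEquivalence)
open import Relation.Nullary using (¬_; Dec; yes; no; does; contradiction)
open import Relation.Nullary.Decidable
  using (_×-dec_; _⊎-dec_; ¬?; decidable-stable; dec-true; dec-false)
open import Relation.Unary using (Decidable)

open Graph using (order; nonEmpty; N; symmetric)
open LIHom

private
  variable
    k m n : ℕ

-- Sums over subsets

⟦_⟧ : {P : Fin n → Set} → Decidable P → Subset n
⟦ P? ⟧ = tabulate (does ∘ P?)

∈⟦⟧⁺ : {P : Fin n → Set} (P? : Decidable P) {x : Fin n} → P x → x ∈ ⟦ P? ⟧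
∈⟦⟧⁺ P? {x} px = lookup⇒[]= x _ (trans (lookup∘tabulate (does ∘ P?) x) (dec-true (P? x) px))

∈⟦⟧⁻ : {P : Fin n → Set} (P? : Decidable P) {x : Fin n} → x ∈ ⟦ P? ⟧ → P x
∈⟦⟧⁻ P? {x} x∈ with P? x | trans (sym (lookup∘tabulate (does ∘ P?) x)) ([]=⇒lookup x∈)
... | yes px | _ = px
... | no _   | ()

x∈p-y⇒x≢y : {p : Subset n} {x y : Fin n} → x ∈ p - y → x ≢ y
x∈p-y⇒x≢y {p = inside  ∷ p} {zero} {zero} () refl
x∈p-y⇒x≢y {p = outside ∷ p} {zero} {zero} () refl
x∈p-y⇒x≢y {p = _ ∷ p} {suc x} (there x∈) refl = x∈p-y⇒x≢y x∈ refl

∑ : Subset n → (Fin n → ℕ) → ℕ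
∑ []            f = 0
∑ (inside  ∷ p) f = f zero + ∑ p (f ∘ suc)
∑ (outside ∷ p) f = ∑ p (f ∘ suc)

∑-cong : (p : Subset n) {f g : Fin n → ℕ} → (∀ {x} → x ∈ p → f x ≡ g x) → ∑ p f ≡ ∑ p g
∑-cong []            e = refl
∑-cong (inside  ∷ p) e = cong₂ _+_ (e here) (∑-cong p (e ∘ there))
∑-cong (outside ∷ p) e = ∑-cong p (e ∘ there)

∑-one : (p : Subset n) → ∑ p (λ _ → 1) ≡ ∣ p ∣
∑-one []            = refl
∑-one (inside  ∷ p) = cong suc (∑-one p)
∑-one (outside ∷ p) = ∑-one p

∑-remove : {p : Subset n} {x : Fin n} (f : Fin n → ℕ) → x ∈ p → ∑ p f ≡ f x + ∑ (p - x) f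
∑-remove {p = _ ∷ p} f here = cong (λ q → f zero + ∑ q (f ∘ suc)) (sym (p─⊥≡p p))
∑-remove {p = outside ∷ p} f (there x∈p) = ∑-remove (f ∘ suc) x∈p
∑-remove {p = inside ∷ p} {suc x} f (there x∈p) =
  trans (cong (f zero +_) (∑-remove (f ∘ suc) x∈p))
        (solve 3 (λ a b c → a :+ (b :+ c) := b :+ (a :+ c)) refl (f zero) (f (suc x)) _)
  where open +-*-Solver

term≤∑ : {p : Subset n} {x : Fin n} (f : Fin n → ℕ) → x ∈ p → f x ≤ ∑ p f
term≤∑ f x∈p = ≤-trans (m≤m+n _ _) (≤-reflexive (sym (∑-remove f x∈p)))

-- φ takes membership proofs, so that it can also be the partial inverse of a map.
record Embedding (p : Subset m) (q : Subset n) : Set where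
  field
    φ           : ∀ {x} → x ∈ p → Fin n
    φ∈          : ∀ {x} (i : x ∈ p) → φ i ∈ q
    φ-injective : ∀ {x y} (i : x ∈ p) (j : y ∈ p) → φ i ≡ φ j → x ≡ y

open Embedding

embed-tail : ∀ {s} {p : Subset m} {q : Subset n} → Embedding (s ∷ p) q → Embedding p q
embed-tail e .φ i = φ e (there i)
embed-tail e .φ∈ i = φ∈ e (there i)
embed-tail e .φ-injective i j eq = suc-injective (φ-injective e (there i) (there j) eq)

embed-into-remove : {p : Subset m} {q : Subset n} {y : Fin n} (e : Embedding p q) →
  (∀ {x} (i : x ∈ p) → φ e i ≢ y) → Embedding p (q - y)
embed-into-remove e avoid .φ = φ e
embed-into-remove e avoid .φ∈ i = x∈p∧x≢y⇒x∈p-y (φ∈ e i) (avoid i)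
embed-into-remove e avoid .φ-injective = φ-injective e

embed-remove : {p : Subset m} {q : Subset n} {x : Fin m} (e : Embedding p q) (x∈p : x ∈ p) →
  Embedding (p - x) (q - φ e x∈p)
embed-remove {p = p} {x = x} e x∈p .φ i = φ e (p─q⊆p p ⁅ x ⁆ i)
embed-remove {p = p} {x = x} e x∈p .φ∈ i = x∈p∧x≢y⇒x∈p-y (φ∈ e _)
  (λ eq → x∈p-y⇒x≢y i (φ-injective e _ x∈p eq))
embed-remove e x∈p .φ-injective i j = φ-injective e _ _

-- By induction on `p`: the image of the head is split off from `q`, and injectivity keeps the
-- images of the tail inside the rest.
∑-mono : {p : Subset m} {q : Subset n} (e : Embedding p q) {f : Fin m → ℕ} {g : Fin n → ℕ} →
  (∀ {x} (i : x ∈ p) → f x ≤ g (φ e i)) → ∑ p f ≤ ∑ q g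
∑-mono {p = []}          e le = z≤n
∑-mono {p = outside ∷ p} e le = ∑-mono (embed-tail e) (le ∘ there)
∑-mono {p = inside ∷ p} {q} e {f} {g} le = begin
  f zero + ∑ p (f ∘ suc)                 ≤⟨ +-mono-≤ (le here) (∑-mono e′ (le ∘ there)) ⟩
  g (φ e here) + ∑ (q - φ e here) g      ≡⟨ ∑-remove g (φ∈ e here) ⟨
  ∑ q g                                  ∎
  where
  open ≤-Reasoning
  e′ = embed-into-remove (embed-tail e)
    (λ i eq → contradiction (φ-injective e (there i) here eq) λ ())

-- An element outside the image contributes a positive term that nothing on the left accounts for.
-- This is the source of strictness at a missed neighbour.
∑-mono-<-omitted : {p : Subset m} {q : Subset n} (e : Embedding p q) {f : Fin m → ℕ} {g : Fin n → ℕ} →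
  (∀ {x} (i : x ∈ p) → f x ≤ g (φ e i)) →
  ∀ {y} → y ∈ q → (∀ {x} (i : x ∈ p) → φ e i ≢ y) → 0 < g y → ∑ p f < ∑ q g
∑-mono-<-omitted {p = p} {q} e {f} {g} le {y} y∈q omitted gy>0 = begin-strict
  ∑ p f               ≤⟨ ∑-mono (embed-into-remove e omitted) le ⟩
  ∑ (q - y) g         <⟨ m<n+m _ gy>0 ⟩
  g y + ∑ (q - y) g   ≡⟨ ∑-remove g y∈q ⟨
  ∑ q g               ∎
  where open ≤-Reasoning

∑-mono-<-at : {p : Subset m} {q : Subset n} (e : Embedding p q) {f : Fin m → ℕ} {g : Fin n → ℕ} →
  (∀ {x} (i : x ∈ p) → f x ≤ g (φ e i)) →
  ∀ {x} (i : x ∈ p) → f x < g (φ e i) → ∑ p f < ∑ q g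
∑-mono-<-at {p = p} {q} e {f} {g} le {x} i lt = begin-strict
  ∑ p f                          ≡⟨ ∑-remove f i ⟩
  f x + ∑ (p - x) f              <⟨ +-mono-<-≤ lt (∑-mono (embed-remove e i) (λ j → le _)) ⟩
  g (φ e i) + ∑ (q - φ e i) g    ≡⟨ ∑-remove g (φ∈ e i) ⟨
  ∑ q g                          ∎
  where open ≤-Reasoning

∑-zero : (p : Subset n) {f : Fin n → ℕ} → (∀ {x} → x ∈ p → f x ≡ 0) → ∑ p f ≡ 0
∑-zero []            e = refl
∑-zero (inside  ∷ p) e = cong₂ _+_ (e here) (∑-zero p (e ∘ there))
∑-zero (outside ∷ p) e = ∑-zero p (e ∘ there)

∑-+ : (p : Subset n) (f g : Fin n → ℕ) → ∑ p (λ x → f x + g x) ≡ ∑ p f + ∑ p g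
∑-+ []            f g = refl
∑-+ (outside ∷ p) f g = ∑-+ p (f ∘ suc) (g ∘ suc)
∑-+ (inside  ∷ p) f g = trans (cong (f zero + g zero +_) (∑-+ p (f ∘ suc) (g ∘ suc)))
  (solve 4 (λ a b c d → a :+ b :+ (c :+ d) := a :+ c :+ (b :+ d)) refl (f zero) (g zero) _ _)
  where open +-*-Solver

∑-comm : (p : Subset m) (q : Subset n) (h : Fin m → Fin n → ℕ) →
  ∑ p (λ x → ∑ q (h x)) ≡ ∑ q (λ y → ∑ p (λ x → h x y))
∑-comm []            q h = sym (∑-zero q (λ _ → refl))
∑-comm (outside ∷ p) q h = ∑-comm p q (h ∘ suc)
∑-comm (inside  ∷ p) q h =
  trans (cong (∑ q (h zero) +_) (∑-comm p q (h ∘ suc))) (sym (∑-+ q (h zero) _))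

χ : {A : Set} → Dec A → ℕ
χ a? = if does a? then 1 else 0

χ-cong : {A B : Set} (a? : Dec A) (b? : Dec B) → (A → B) → (B → A) → χ a? ≡ χ b?
χ-cong (yes a) (yes b) f g = refl
χ-cong (yes a) (no ¬b) f g = contradiction (f a) ¬b
χ-cong (no ¬a) (yes b) f g = contradiction (g b) ¬a
χ-cong (no ¬a) (no ¬b) f g = refl

χ-mono : {A B : Set} (a? : Dec A) (b? : Dec B) → (A → B) → χ a? ≤ χ b?
χ-mono (yes a) (yes b) f = ≤-refl
χ-mono (yes a) (no ¬b) f = contradiction (f a) ¬b
χ-mono (no ¬a) b?      f = z≤n

χ-yes : {A : Set} (a? : Dec A) → A → χ a? ≡ 1
χ-yes (yes _) a = refl
χ-yes (no ¬a) a = contradiction a ¬a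

χ-no : {A : Set} (a? : Dec A) → ¬ A → χ a? ≡ 0
χ-no (yes a) ¬a = contradiction a ¬a
χ-no (no _)  ¬a = refl

∑-χ : (p q : Subset n) {P : Fin n → Set} (P? : Decidable P) (c : ℕ) →
  (∀ {x} → x ∈ q → P x) → (∀ {x} → P x → x ∈ q) → ∑ p (λ x → χ (P? x) * c) ≡ ∣ p ∩ q ∣ * c
∑-χ []      []      P? c to from = refl
∑-χ (outside ∷ p) (_ ∷ q) P? c to from = ∑-χ p q (P? ∘ suc) c (to ∘ there) (drop-there ∘ from)
∑-χ (inside ∷ p) (outside ∷ q) P? c to from
  rewrite χ-no (P? zero) (λ p0 → contradiction (from p0) λ ()) =
  ∑-χ p q (P? ∘ suc) c (to ∘ there) (drop-there ∘ from)
∑-χ (inside ∷ p) (inside ∷ q) P? c to from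
  rewrite χ-yes (P? zero) (to here) =
  cong₂ _+_ (+-identityʳ c) (∑-χ p q (P? ∘ suc) c (to ∘ there) (drop-there ∘ from))

-- Double counting: `c (idx v)` is expanded into a sum over all blocks with indicator coefficients,
-- and the two sums are exchanged.
∑-partition : (p : Subset n) (B : Fin k → Subset n) (idx : Fin n → Fin k) →
  (∀ v → v ∈ B (idx v)) → (∀ {v j} → v ∈ B j → idx v ≡ j) →
  (c : Fin k → ℕ) → ∑ p (c ∘ idx) ≡ ∑ ⊤ (λ j → ∣ p ∩ B j ∣ * c j)
∑-partition {k = k} p B idx here∈ unique c = begin
  ∑ p (c ∘ idx)                                      ≡⟨ ∑-cong p (λ {v} _ → pick v) ⟩
  ∑ p (λ v → ∑ ⊤ (λ j → χ (v ∈? B j) * c j))         ≡⟨ ∑-comm p (⊤ {k}) (λ v j → χ (v ∈? B j) * c j) ⟩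
  ∑ ⊤ (λ j → ∑ p (λ v → χ (v ∈? B j) * c j))         ≡⟨ ∑-cong ⊤ (λ {j} _ → ∑-χ p (B j) (_∈? B j) (c j) id id) ⟩
  ∑ ⊤ (λ j → ∣ p ∩ B j ∣ * c j)                      ∎
  where
  open ≡-Reasoning
  pick : ∀ v → c (idx v) ≡ ∑ ⊤ (λ j → χ (v ∈? B j) * c j)
  pick v = sym (begin
    ∑ ⊤ t                             ≡⟨ ∑-remove t ∈⊤ ⟩
    t (idx v) + ∑ (⊤ - idx v) t       ≡⟨ cong₂ _+_ main rest ⟩
    c (idx v) + 0                     ≡⟨ +-identityʳ _ ⟩
    c (idx v)                         ∎)
    where
    t = λ j → χ (v ∈? B j) * c j
    main : t (idx v) ≡ c (idx v)
    main rewrite χ-yes (v ∈? B (idx v)) (here∈ v) = *-identityˡ _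
    rest : ∑ (⊤ - idx v) t ≡ 0
    rest = ∑-zero (⊤ - idx v) (λ {j} j∈ → cong (_* c j)
      (χ-no (v ∈? B j) (λ v∈ → x∈p-y⇒x≢y j∈ (sym (unique v∈)))))

-- Distinct elements of large subsets

remove-size : {p : Subset n} {x : Fin n} → x ∈ p → ∣ p ∣ ≡ suc ∣ p - x ∣
remove-size {p = p} {x} x∈p = begin
  ∣ p ∣                        ≡⟨ ∑-one p ⟨
  ∑ p (λ _ → 1)                ≡⟨ ∑-remove _ x∈p ⟩
  suc (∑ (p - x) (λ _ → 1))    ≡⟨ cong suc (∑-one (p - x)) ⟩
  suc ∣ p - x ∣                ∎
  where open ≡-Reasoning

element : (p : Subset n) → 0 < ∣ p ∣ → ∃[ x ] x ∈ p
element (inside  ∷ p) _  = zero , here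
element (outside ∷ p) lt with x , x∈p ← element p lt = suc x , there x∈p

remove-element : (p : Subset n) → suc k ≤ ∣ p ∣ → ∃[ x ] x ∈ p × k ≤ ∣ p - x ∣
remove-element p lt with x , x∈p ← element p (≤-trans (s≤s z≤n) lt) =
  x , x∈p , s≤s⁻¹ (≤-trans lt (≤-reflexive (remove-size x∈p)))

nonempty⇒size>0 : {p : Subset n} {x : Fin n} → x ∈ p → 0 < ∣ p ∣
nonempty⇒size>0 x∈p rewrite remove-size x∈p = s≤s z≤n

Two : Subset n → Set
Two p = ∃[ x ] ∃[ y ] x ∈ p × y ∈ p × x ≢ y

record Three (p : Subset n) : Set where
  constructor three
  field
    {x y z} : Fin n
    x∈      : x ∈ p
    y∈      : y ∈ p
    z∈      : z ∈ p
    x≢y     : x ≢ y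
    x≢z     : x ≢ z
    y≢z     : y ≢ z

size⇒two : (p : Subset n) → 2 ≤ ∣ p ∣ → Two p
size⇒two p le with remove-element p le
... | x , x∈ , le₁ with remove-element (p - x) le₁
... | y , y∈ , _ = x , y , x∈ , p─q⊆p p ⁅ x ⁆ y∈ , (λ eq → x∈p-y⇒x≢y y∈ (sym eq))

size⇒three : (p : Subset n) → 3 ≤ ∣ p ∣ → Three p
size⇒three p le with remove-element p le
... | x , x∈ , le₁ with size⇒two (p - x) le₁
... | y , z , y∈ , z∈ , y≢z = three x∈ (p─q⊆p p ⁅ x ⁆ y∈) (p─q⊆p p ⁅ x ⁆ z∈)
  (λ eq → x∈p-y⇒x≢y y∈ (sym eq)) (λ eq → x∈p-y⇒x≢y z∈ (sym eq)) y≢z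

two⇒size : {p : Subset n} → Two p → 2 ≤ ∣ p ∣
two⇒size (x , y , x∈ , y∈ , x≢y) rewrite remove-size x∈ =
  s≤s (nonempty⇒size>0 (x∈p∧x≢y⇒x∈p-y y∈ (λ eq → x≢y (sym eq))))

three⇒size : {p : Subset n} → Three p → 3 ≤ ∣ p ∣
three⇒size (three x∈ y∈ z∈ x≢y x≢z y≢z) rewrite remove-size x∈ =
  s≤s (two⇒size (_ , _ , x∈p∧x≢y⇒x∈p-y y∈ (λ eq → x≢y (sym eq)) ,
                 x∈p∧x≢y⇒x∈p-y z∈ (λ eq → x≢z (sym eq)) , y≢z))

two-avoid : {p : Subset n} → Two p → ∀ a → ∃[ b ] b ∈ p × b ≢ a
two-avoid (x , y , x∈ , y∈ , x≢y) a with x ≟ a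
... | no x≢a   = x , x∈ , x≢a
... | yes refl = y , y∈ , x≢y ∘ sym

three-avoid : {p : Subset n} (t : Three p) → ∀ a → ∃[ b ] b ∈ p × b ≢ a × b ≢ Three.x t
three-avoid (three {y = y} _ y∈ z∈ x≢y x≢z y≢z) a with y ≟ a
... | no y≢a   = y , y∈ , y≢a , x≢y ∘ sym
... | yes refl = _ , z∈ , y≢z ∘ sym , x≢z ∘ sym

-- Walks and the strict order

someVertex : (G : Graph) → Vertex G
someVertex record { order = suc _ } = zero

≤LI-refl : ∀ {G} → G ≤LI G
≤LI-refl = record { map = id ; homomorphism = id ; locallyInjective = λ _ _ _ → id }

≤LI-trans : ∀ {G H K} → G ≤LI H → H ≤LI K → G ≤LI K
≤LI-trans f g = record
  { map              = map g ∘ map f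
  ; homomorphism     = homomorphism g ∘ homomorphism f
  ; locallyInjective = λ v x∈ y∈ eq →
      locallyInjective f v x∈ y∈ (locallyInjective g _ (homomorphism f x∈) (homomorphism f y∈) eq)
  }

neighbours : ∀ {G H} (f : G ≤LI H) (v : Vertex G) → Embedding (N G v) (N H (map f v))
neighbours f v .φ {x} _ = map f x
neighbours f v .φ∈ = homomorphism f
neighbours f v .φ-injective = locallyInjective f v

Deficient : ∀ {G H} → G ≤LI H → Vertex G → Vertex H → Set
Deficient {G} {H} f v y = Adj H (map f v) y × (∀ {x} → Adj G v x → map f x ≢ y)

walks : (G : Graph) → ℕ → Vertex G → ℕ
walks G zero    v = 1
walks G (suc n) v = ∑ (N G v) (walks G n)

walks-mono : ∀ {G H} (f : G ≤LI H) n v → walks G n v ≤ walks H n (map f v)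
walks-mono f zero    v = ≤-refl
walks-mono f (suc n) v = ∑-mono (neighbours f v) (λ {x} _ → walks-mono f n x)

walks>0 : ∀ {G} → (∀ v → ∃[ w ] Adj G v w) → ∀ n v → 0 < walks G n v
walks>0 nb zero    v = s≤s z≤n
walks>0 {G} nb (suc n) v with w , w∈ ← nb v = ≤-trans (walks>0 nb n w) (term≤∑ (walks G n) w∈)

infix 4 _≺_

-- Equivalently, for one fixed length the maximal number of walks is smaller in `G` than in `H`. No
-- map between the graphs is involved, so the relation composes with `≤LI` on both sides.
record _≺_ (G H : Graph) : Set where
  constructor dominated
  field
    length    : ℕ
    dominates : ∀ v → ∃[ w ] walks G length v < walks H length w

≤LI-≺-trans : ∀ {G H K} → G ≤LI H → H ≺ K → G ≺ K
≤LI-≺-trans f (dominated n lt) = dominated n λ v →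
  let w , v<w = lt (map f v) in w , ≤-<-trans (walks-mono f n v) v<w

≺-≤LI-trans : ∀ {G H K} → G ≺ H → H ≤LI K → G ≺ K
≺-≤LI-trans (dominated n lt) f = dominated n λ v →
  let w , v<w = lt v in map f w , <-≤-trans v<w (walks-mono f n w)

-- Repeated ascent would exceed the sum of all values of `h`, which bounds each of them; so there is
-- no point to start from.
no-ascent : (h : Fin n → ℕ) → (∀ v → ∃[ w ] h v < h w) → ¬ Fin n
no-ascent h up v₀ = let _ , le = climb (suc (∑ ⊤ h)) in <-irrefl refl (≤-trans le (term≤∑ h ∈⊤))
  where
  climb : ∀ k → ∃[ v ] k ≤ h v
  climb zero    = v₀ , z≤n
  climb (suc k) with v , k≤ ← climb k with w , v<w ← up v = w , ≤-trans (s≤s k≤) v<w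

≺⇒≰LI : ∀ {G H} → G ≺ H → ¬ H ≤LI G
≺⇒≰LI {G} G≺H f with dominated n lt ← ≺-≤LI-trans G≺H f = no-ascent (walks G n) lt (someVertex G)

connected⇒neighbour : ∀ G → Connected G → ∀ {a b} → Adj G a b → ∀ v → ∃[ w ] Adj G v w
connected⇒neighbour G conn {a} {b} ab v with conn v a
... | ε     = b , ab
... | e ◅ _ = _ , e

-- At `u` the missed `y` begins walks of `H` that no walk of `G` is mapped to. Every `v` has a walk
-- to `u`, along which this surplus is carried back to `v`.
deficient⇒≺ : ∀ {G H} (f : G ≤LI H) → Connected G → Connected H → ∀ {u y} → Deficient f u y → G ≺ H
deficient⇒≺ {G} {H} f connG connH {u} {y} (y∈ , missed) =
  dominated bound λ v → map f v , strict (connG v u) (term≤∑ distance ∈⊤)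
  where
  length : ∀ {v} → Star (Adj G) v u → ℕ
  -- Even at `u` one step is needed to see the surplus: all vertices have a single walk of length
  -- zero.
  length ε       = 1
  length (_ ◅ p) = suc (length p)
  distance : Vertex G → ℕ
  distance v = length (connG v u)
  bound : ℕ
  -- The sum is a convenient common upper bound; `strict` allows any length from `length p` on.
  bound = ∑ ⊤ distance
  strict : ∀ {v} (p : Star (Adj G) v u) {n} → length p ≤ n → walks G n v < walks H n (map f v)
  strict ε {suc n} _ = ∑-mono-<-omitted (neighbours f u) (λ {x} _ → walks-mono f n x) y∈ missed
    (walks>0 (connected⇒neighbour H connH y∈) n y)
  strict (e ◅ p) {suc n} (s≤s le) =
    ∑-mono-<-at (neighbours f _) (λ {x} _ → walks-mono f n x) e (strict p le)

-- Walk counts are determined by the degree refinement matrix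

module Blocks {G : Graph} (P : EquitablePartition G) where
  open EquitablePartition P public

  index : Vertex G → Fin size
  index v = proj₁ (exactlyOne v)

  ∈index : ∀ v → v ∈ block (index v)
  ∈index v = proj₁ (proj₂ (exactlyOne v))

  index-unique : ∀ {v i} → v ∈ block i → index v ≡ i
  index-unique {v} = proj₂ (proj₂ (exactlyOne v))

  representative : Fin size → Vertex G
  representative i = proj₁ (nonempty i)

  representative∈ : ∀ i → representative i ∈ block i
  representative∈ i = proj₂ (nonempty i)

module _ {G H : Graph} (P : EquitablePartition G) (Q : EquitablePartition H) (same : SameMatrix P Q) where
  private
    module P = Blocks P
    module Q = Blocks Q
    π = proj₁ same

  -- Both functions are constant on corresponding blocks, so each sum is a combination of block
  -- values whose coefficients are the matrix entries of `i`, and these agree.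
  neighbour-sums-agree : ∀ {h : Vertex G → ℕ} {h′ : Vertex H → ℕ} →
    (∀ {i u v} → u ∈ P.block i → v ∈ Q.block (π ⟨$⟩ʳ i) → h u ≡ h′ v) →
    ∀ {i u v} → u ∈ P.block i → v ∈ Q.block (π ⟨$⟩ʳ i) → ∑ (N G u) h ≡ ∑ (N H v) h′
  neighbour-sums-agree {h} {h′} agree {i} {u} {v} u∈ v∈ = begin
    ∑ (N G u) h                                      ≡⟨ ∑-cong (N G u) (λ {x} _ → h-index x) ⟩
    ∑ (N G u) (c ∘ P.index)                          ≡⟨ ∑-partition (N G u) P.block P.index P.∈index P.index-unique c ⟩
    ∑ ⊤ (λ j → ∣ N G u ∩ P.block j ∣ * c j)          ≡⟨ ∑-cong ⊤ (λ {j} _ → cong (_* c j) (counts j)) ⟩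
    ∑ ⊤ (λ j → ∣ N H v ∩ B j ∣ * c j)                ≡⟨ ∑-partition (N H v) B index′ ∈index′ index′-unique c ⟨
    ∑ (N H v) (c ∘ index′)                           ≡⟨ ∑-cong (N H v) (λ {x} _ → h′-index x) ⟨
    ∑ (N H v) h′                                     ∎
    where
    open ≡-Reasoning
    B : Fin P.size → Subset (order H)
    B j = Q.block (π ⟨$⟩ʳ j)
    index′ : Vertex H → Fin P.size
    index′ x = π ⟨$⟩ˡ Q.index x
    ∈index′ : ∀ x → x ∈ B (index′ x)
    ∈index′ x = subst (λ j → x ∈ Q.block j) (sym (inverseʳ π)) (Q.∈index x)
    index′-unique : ∀ {x j} → x ∈ B j → index′ x ≡ j
    index′-unique x∈ = trans (cong (π ⟨$⟩ˡ_) (Q.index-unique x∈)) (inverseˡ π)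
    c : Fin P.size → ℕ
    c j = h′ (Q.representative (π ⟨$⟩ʳ j))
    h-index : ∀ x → h x ≡ c (P.index x)
    h-index x = agree (P.∈index x) (Q.representative∈ _)
    h′-index : ∀ x → h′ x ≡ c (index′ x)
    h′-index x = trans (sym (agree (P.representative∈ _) (∈index′ x)))
                       (agree (P.representative∈ _) (Q.representative∈ _))
    counts : ∀ j → ∣ N G u ∩ P.block j ∣ ≡ ∣ N H v ∩ B j ∣
    counts j = trans (P.equitable i j u∈) (trans (proj₂ same i j) (sym (Q.equitable _ _ v∈)))

  walks-agree : ∀ n {i u v} → u ∈ P.block i → v ∈ Q.block (π ⟨$⟩ʳ i) → walks G n u ≡ walks H n v
  walks-agree zero    _ _ = refl
  walks-agree (suc n) = neighbour-sums-agree (walks-agree n)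

-- Equal matrices would make every walk count of `H` occur in `G`, so each count in `G` would be
-- exceeded by another one in `G`. Both orientations are stated since `F` is the larger graph
-- against `G` and the smaller one against `H`.
≺⇒≉drm : ∀ {G H} → G ≺ H → ¬ G ≈drm H × ¬ H ≈drm G
≺⇒≉drm {G} {H} (dominated n lt) = G≉H , H≉G
  where
  G≉H : ¬ G ≈drm H
  G≉H (P , Q , _ , _ , same@(π , _)) = no-ascent (walks G n) up (someVertex G)
    where
    module P = Blocks P
    module Q = Blocks Q
    up : ∀ v → ∃[ v′ ] walks G n v < walks G n v′
    up v with w , v<w ← lt v =
      let i = π ⟨$⟩ˡ Q.index w in
      P.representative i ,
      <-≤-trans v<w (≤-reflexive (sym (walks-agree P Q same n (P.representative∈ i)
        (subst (λ j → w ∈ Q.block j) (sym (inverseʳ π)) (Q.∈index w)))))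
  H≉G : ¬ H ≈drm G
  H≉G (P , Q , _ , _ , same@(π , _)) = no-ascent (walks G n) up (someVertex G)
    where
    module P = Blocks P
    module Q = Blocks Q
    up : ∀ v → ∃[ v′ ] walks G n v < walks G n v′
    up v with w , v<w ← lt v =
      Q.representative (π ⟨$⟩ʳ P.index w) ,
      <-≤-trans v<w (≤-reflexive (walks-agree P Q same n (P.∈index w) (Q.representative∈ _)))

sameMatrix-refl : ∀ {G} (P : EquitablePartition G) → SameMatrix P P
sameMatrix-refl P = Perm.id , λ _ _ → refl

-- Colour refinement and coverings

record Quotient (_~_ : Fin n → Fin n → Set) : Set where
  field
    size       : ℕ
    class      : Fin n → Fin size
    surjective : ∀ i → ∃[ v ] class v ≡ i
    sound      : ∀ {u v} → u ~ v → class u ≡ class v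
    complete   : ∀ {u v} → class u ≡ class v → u ~ v

open Quotient

-- The first element joins the class of a related later element, or opens a new class if there is
-- none.
quotient : {_~_ : Fin n → Fin n → Set} → IsEquivalence _~_ → Binary.Decidable _~_ → Quotient _~_
quotient {zero} eq _~?_ = record
  { size = 0 ; class = id ; surjective = λ () ; sound = λ { {()} } ; complete = λ { {()} } }
quotient {suc n} {_~_} eq _~?_ with quotient
  {_~_ = λ u v → suc u ~ suc v}
  (record { refl = ~.refl ; sym = ~.sym ; trans = ~.trans }) (λ u v → suc u ~? suc v)
  | any? (λ v → zero ~? suc v)
  where module ~ = IsEquivalence eq
... | Q | yes (w , 0~w) = record
  { size       = size Q
  ; class      = cls
  ; surjective = λ i → let v , eq = surjective Q i in suc v , eq
  ; sound      = snd
  ; complete   = cmp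
  }
  where
  module ~ = IsEquivalence eq
  cls : Fin (suc n) → Fin (size Q)
  cls zero    = class Q w
  cls (suc v) = class Q v
  snd : ∀ {u v} → u ~ v → cls u ≡ cls v
  snd {zero}  {zero}  _ = refl
  snd {zero}  {suc v} r = sound Q (~.trans (~.sym 0~w) r)
  snd {suc u} {zero}  r = sound Q (~.trans r 0~w)
  snd {suc u} {suc v} r = sound Q r
  cmp : ∀ {u v} → cls u ≡ cls v → u ~ v
  cmp {zero}  {zero}  _ = ~.refl
  cmp {zero}  {suc v} e = ~.trans 0~w (complete Q e)
  cmp {suc u} {zero}  e = ~.trans (complete Q e) (~.sym 0~w)
  cmp {suc u} {suc v} e = complete Q e
... | Q | no new = record
  { size       = suc (size Q)
  ; class      = cls
  ; surjective = srj
  ; sound      = snd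
  ; complete   = cmp
  }
  where
  module ~ = IsEquivalence eq
  cls : Fin (suc n) → Fin (suc (size Q))
  cls zero    = zero
  cls (suc v) = suc (class Q v)
  srj : ∀ i → ∃[ v ] cls v ≡ i
  srj zero    = zero , refl
  srj (suc i) = let v , eq = surjective Q i in suc v , cong suc eq
  snd : ∀ {u v} → u ~ v → cls u ≡ cls v
  snd {zero}  {zero}  _ = refl
  snd {zero}  {suc v} r = contradiction (v , r) new
  snd {suc u} {zero}  r = contradiction (u , ~.sym r) new
  snd {suc u} {suc v} r = cong suc (sound Q r)
  cmp : ∀ {u v} → cls u ≡ cls v → u ~ v
  cmp {zero}  {zero}  _ = ~.refl
  cmp {suc u} {suc v} e = complete Q (suc-injective e)

module Refinement (H : Graph) where

  -- Colour refinement after `n` rounds. A class is named by any member `w`, so no colours have to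
  -- be numbered between rounds.
  E  : ℕ → Vertex H → Vertex H → Set
  E? : ∀ n u v → Dec (E n u v)

  E zero    u v = Unit.⊤
  E (suc n) u v = E n u v × (∀ w → ∑ (N H u) (χ ∘ E? n w) ≡ ∑ (N H v) (χ ∘ E? n w))

  E? zero    u v = yes Unit.tt
  E? (suc n) u v = E? n u v ×-dec all? (λ w → _ ℕ.≟ _)

  E-isEquivalence : ∀ n → IsEquivalence (E n)
  E-isEquivalence zero = record { refl = Unit.tt ; sym = λ _ → Unit.tt ; trans = λ _ _ → Unit.tt }
  E-isEquivalence (suc n) = record
    { refl  = E.refl , λ _ → refl
    ; sym   = λ (e , s) → E.sym e , λ w → sym (s w)
    ; trans = λ (e , s) (e′ , s′) → E.trans e e′ , λ w → trans (s w) (s′ w)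
    }
    where module E = IsEquivalence (E-isEquivalence n)

  -- The number of ordered pairs not yet separated, which measures the progress of the refinement.
  μ : ℕ → ℕ
  μ n = ∑ ⊤ (λ u → ∑ ⊤ (λ v → χ (E? n u v)))

  μ-decreases : ∀ n {u v} → E n u v → ¬ E (suc n) u v → μ (suc n) < μ n
  μ-decreases n {u} {v} e ¬e = ∑-mono-<-at whole
    (λ {u} _ → ∑-mono whole (λ {v} _ → χ-mono (E? (suc n) u v) (E? n u v) proj₁))
    {u} ∈⊤
    (∑-mono-<-at whole (λ {v} _ → χ-mono (E? (suc n) u v) (E? n u v) proj₁) {v} ∈⊤
      (subst₂ _<_ (sym (χ-no (E? (suc n) u v) ¬e)) (sym (χ-yes (E? n u v) e)) (s≤s z≤n)))
    where
    whole : ∀ {m} → Embedding (⊤ {m}) (⊤ {m})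
    whole = record { φ = λ {x} _ → x ; φ∈ = id ; φ-injective = λ _ _ → id }

  stabilises : ∃[ n ] ∀ {u v} → E n u v → E (suc n) u v
  -- The fuel exceeds the initial measure, and each round that separates a pair lowers the measure,
  -- so the fuel cannot run out.
  stabilises = search (suc (μ 0)) 0 ≤-refl
    where
    search : ∀ k n → μ n < k → ∃[ n ] ∀ {u v} → E n u v → E (suc n) u v
    search (suc k) n lt with any? (λ u → any? (λ v → E? n u v ×-dec ¬? (E? (suc n) u v)))
    ... | yes (u , v , e , ¬e) = search k (suc n) (<-≤-trans (μ-decreases n e ¬e) (s≤s⁻¹ lt))
    ... | no stable = n , λ {u} {v} e →
      decidable-stable (E? (suc n) u v) (λ ¬e → stable (u , v , e , ¬e))

  level : ℕ
  level = proj₁ stabilises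

  colours : Quotient (E level)
  colours = quotient (E-isEquivalence level) (E? level)

  colour : Vertex H → Fin (size colours)
  colour = class colours

  sample : Fin (size colours) → Vertex H
  sample i = proj₁ (surjective colours i)

  -- At the stable level a further round separates nothing, which is equitability; colour `j` is the
  -- class of `sample j`.
  E⇒equal-counts : ∀ {u v} → E level u v → ∀ j →
    ∑ (N H u) (λ x → χ (colour x ≟ j)) ≡ ∑ (N H v) (λ x → χ (colour x ≟ j))
  E⇒equal-counts {u} {v} e j = begin
    ∑ (N H u) (λ x → χ (colour x ≟ j))     ≡⟨ ∑-cong (N H u) (λ {x} _ → same x) ⟩
    ∑ (N H u) (χ ∘ E? level (sample j))    ≡⟨ proj₂ (proj₂ stabilises e) (sample j) ⟩
    ∑ (N H v) (χ ∘ E? level (sample j))    ≡⟨ ∑-cong (N H v) (λ {x} _ → same x) ⟨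
    ∑ (N H v) (λ x → χ (colour x ≟ j))     ∎
    where
    open ≡-Reasoning
    same : ∀ x → χ (colour x ≟ j) ≡ χ (E? level (sample j) x)
    same x = χ-cong (colour x ≟ j) (E? level (sample j) x)
      (λ eq → complete colours (trans (proj₂ (surjective colours j)) (sym eq)))
      (λ e → trans (sym (sound colours e)) (proj₂ (surjective colours j)))

-- With the local injectivity of `f`, `locallyOnto` makes `f` bijective on every neighbourhood.
record Covering {G H : Graph} (f : G ≤LI H) : Set where
  field
    onto        : ∀ w → ∃[ v ] map f v ≡ w
    locallyOnto : ∀ v {y} → Adj H (map f v) y → ∃[ x ] Adj G v x × map f x ≡ y

module Pullback {G H : Graph} (f : G ≤LI H) (cov : Covering f) where
  open Refinement H
  open Covering cov

  -- One inequality comes from mapping neighbours down, the other from lifting them.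
  ∑-pullback : ∀ (h : Vertex H → ℕ) v → ∑ (N G v) (h ∘ map f) ≡ ∑ (N H (map f v)) h
  ∑-pullback h v = ≤-antisym (∑-mono (neighbours f v) (λ _ → ≤-refl))
    (∑-mono lifts (λ y∈ → ≤-reflexive (cong h (sym (proj₂ (proj₂ (locallyOnto v y∈)))))))
    where
    lifts : Embedding (N H (map f v)) (N G v)
    lifts .φ y∈ = proj₁ (locallyOnto v y∈)
    lifts .φ∈ y∈ = proj₁ (proj₂ (locallyOnto v y∈))
    lifts .φ-injective y∈ y′∈ eq = trans (sym (proj₂ (proj₂ (locallyOnto v y∈))))
      (trans (cong (map f) eq) (proj₂ (proj₂ (locallyOnto v y′∈))))

  -- The matrix is read off in `H` alone, so the pullbacks along any two coverings of `H` share it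
  -- by definition. One of them is the identity of `H`.
  part : EquitablePartition G
  part = record
    { size       = size colours
    ; block      = block
    ; nonempty   = λ i → let v , fv = onto (sample i) in
        v , ∈⟦⟧⁺ (in? i) (trans (cong colour fv) (proj₂ (surjective colours i)))
    ; exactlyOne = λ v → colour (map f v) , ∈⟦⟧⁺ (in? _) refl , ∈⟦⟧⁻ (in? _)
    ; matrix     = λ i j → ∑ (N H (sample i)) (λ x → χ (colour x ≟ j))
    ; equitable  = equit
    }
    where
    open ≡-Reasoning
    in? : ∀ i v → Dec (colour (map f v) ≡ i)
    in? i v = colour (map f v) ≟ i
    block : Fin (size colours) → Subset (order G)
    block i = ⟦ in? i ⟧
    equit : ∀ i j {u} → u ∈ block i →
      ∣ N G u ∩ block j ∣ ≡ ∑ (N H (sample i)) (λ x → χ (colour x ≟ j))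
    equit i j {u} u∈ = begin
      ∣ N G u ∩ block j ∣                                  ≡⟨ *-identityʳ _ ⟨
      ∣ N G u ∩ block j ∣ * 1                              ≡⟨ ∑-χ (N G u) (block j) (in? j) 1 (∈⟦⟧⁻ (in? j)) (∈⟦⟧⁺ (in? j)) ⟨
      ∑ (N G u) (λ x → χ (in? j x) * 1)                    ≡⟨ ∑-cong (N G u) (λ _ → *-identityʳ _) ⟩
      ∑ (N G u) (λ x → χ (in? j x))                        ≡⟨ ∑-pullback (λ x → χ (colour x ≟ j)) u ⟩
      ∑ (N H (map f u)) (λ x → χ (colour x ≟ j))           ≡⟨ E⇒equal-counts
        (complete colours (trans (∈⟦⟧⁻ (in? i) u∈) (sym (proj₂ (surjective colours i))))) j ⟩
      ∑ (N H (sample i)) (λ x → χ (colour x ≟ j))          ∎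

  -- By induction on the rounds, refinement never separates the images of two vertices in one block
  -- of an equitable partition `Q` of `G`.
  coarsest : Coarsest part
  coarsest Q i = colour (map f (Q.representative i)) , λ {x} x∈ →
    ∈⟦⟧⁺ (λ v → colour (map f v) ≟ _) (sound colours (same-E level x∈ (Q.representative∈ i)))
    where
    module Q = Blocks Q
    same-E : ∀ n {i u v} → u ∈ Q.block i → v ∈ Q.block i → E n (map f u) (map f v)
    same-E zero    _  _  = Unit.tt
    same-E (suc n) {u = u} {v} u∈ v∈ = same-E n u∈ v∈ , λ w → begin
      ∑ (N H (map f u)) (χ ∘ E? n w)         ≡⟨ ∑-pullback (χ ∘ E? n w) u ⟨
      ∑ (N G u) (χ ∘ E? n w ∘ map f)         ≡⟨ neighbour-sums-agree Q Q (sameMatrix-refl Q) (agree w) u∈ v∈ ⟩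
      ∑ (N G v) (χ ∘ E? n w ∘ map f)         ≡⟨ ∑-pullback (χ ∘ E? n w) v ⟩
      ∑ (N H (map f v)) (χ ∘ E? n w)         ∎
      where
      open ≡-Reasoning
      agree : ∀ w {i u v} → u ∈ Q.block i → v ∈ Q.block i →
        χ (E? n w (map f u)) ≡ χ (E? n w (map f v))
      agree w u∈ v∈ = χ-cong (E? n w _) (E? n w _)
        (λ e → En.trans e (same-E n u∈ v∈)) (λ e → En.trans e (same-E n v∈ u∈))
        where module En = IsEquivalence (E-isEquivalence n)

covering-refl : ∀ G → Covering (≤LI-refl {G})
covering-refl G = record { onto = λ w → w , refl ; locallyOnto = λ v y∈ → _ , y∈ , refl }

covering⇒≈drm : ∀ {G H} (f : G ≤LI H) → Covering f → G ≈drm H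
covering⇒≈drm {G} {H} f cov =
  F.part , I.part , F.coarsest , I.coarsest , sameMatrix-refl F.part .proj₁ , λ _ _ → refl
  where
  module F = Pullback f cov
  module I = Pullback ≤LI-refl (covering-refl H)

-- A walk in `H` from the image of some vertex to `w` lifts edge by edge.
locallyOnto⇒onto : ∀ {G H} (f : G ≤LI H) → Connected H →
  (∀ v {y} → Adj H (map f v) y → ∃[ x ] Adj G v x × map f x ≡ y) → ∀ w → ∃[ v ] map f v ≡ w
locallyOnto⇒onto {G} {H} f conn lift w = go (conn (map f v₀) w) v₀ refl
  where
  v₀ = someVertex G
  go : ∀ {a} → Star (Adj H) a w → ∀ v → map f v ≡ a → ∃[ v ] map f v ≡ w
  go ε       v eq   = v , eq
  go (e ◅ p) v refl with x , _ , eq ← lift v e = go p x eq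

-- A missed neighbour can be searched for; if there is none, `f` is a covering and the matrices
-- agree.
≉drm⇒deficient : ∀ {G H} → Connected H → ¬ G ≈drm H → (f : G ≤LI H) → ∃[ u ] ∃[ y ] Deficient f u y
≉drm⇒deficient {G} {H} conn G≉H f
  with any? (λ u → any? (λ y → (y ∈? N H (map f u)) ×-dec ¬? (any? (λ x → (x ∈? N G u) ×-dec (map f x ≟ y)))))
... | yes (u , y , y∈ , missed) = u , y , y∈ , λ x∈ eq → missed (_ , x∈ , eq)
... | no none = contradiction (covering⇒≈drm f (record { onto = locallyOnto⇒onto f conn lift ; locallyOnto = lift })) G≉H
  where
  lift : ∀ v {y} → Adj H (map f v) y → ∃[ x ] Adj G v x × map f x ≡ y
  lift v {y} y∈ = decidable-stable (any? (λ x → (x ∈? N G v) ×-dec (map f x ≟ y)))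
    (λ missed → none (v , y , y∈ , missed))

-- Attaching a vertex and adding an edge

module _ (X : Graph) (u : Vertex X) where

  private
    M : Fin (suc (order X)) → Subset (suc (order X))
    M zero    = outside ∷ ⁅ u ⁆
    M (suc v) = does (v ≟ u) ∷ N X v

    tip∈⁺ : zero ∈ M (suc u)
    tip∈⁺ with u ≟ u
    ... | yes _  = here
    ... | no u≢u = contradiction refl u≢u

    tip∈⁻ : ∀ {v} → zero ∈ M (suc v) → v ≡ u
    tip∈⁻ {v} _ with v ≟ u
    tip∈⁻ {v} _  | yes v≡u = v≡u
    tip∈⁻ {v} () | no _

    base∈⁻ : ∀ {x} → x ∈ M zero → x ≡ suc u
    base∈⁻ (there x∈) = cong suc (x∈⁅y⁆⇒x≡y u x∈)

    M-symmetric : ∀ {v w} → v ∈ M w → w ∈ M v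
    M-symmetric {suc v} {zero}  v∈ with refl ← base∈⁻ v∈ = tip∈⁺
    M-symmetric {zero}  {suc w} v∈ with refl ← tip∈⁻ v∈ = there (x∈⁅x⁆ u)
    M-symmetric {suc v} {suc w} (there v∈) = there (symmetric X v∈)

  pendant : Graph
  pendant = record { order = suc (order X) ; nonEmpty = _ ; N = M ; symmetric = M-symmetric }

  tip-adjacent : Adj pendant (suc u) zero
  tip-adjacent = tip∈⁺

  adjacent-tip : ∀ {v} → Adj pendant (suc v) zero → v ≡ u
  adjacent-tip = tip∈⁻

  tip-neighbour : ∀ {x} → Adj pendant zero x → x ≡ suc u
  tip-neighbour = base∈⁻

  pendant-⊇ : X ≤LI pendant
  pendant-⊇ = record
    { map = suc ; homomorphism = there ; locallyInjective = λ _ _ _ → suc-injective }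

  pendant-⊇-deficient : Deficient pendant-⊇ u zero
  pendant-⊇-deficient = tip-adjacent , λ _ ()

  pendant-connected : Connected X → Connected pendant
  pendant-connected conn v w = toTip v ◅◅ Star.reverse (symmetric pendant) (toTip w)
    where
    toTip : ∀ v → Star (Adj pendant) v zero
    toTip zero    = ε
    toTip (suc v) = Star.gmap suc there (conn v u) ◅◅ tip-adjacent ◅ ε

  module _ {H : Graph} (f : X ≤LI H) {y : Vertex H} (def : Deficient f u y) where

    private
      F : Vertex pendant → Vertex H
      F zero    = y
      F (suc v) = map f v

      F-hom : ∀ {v w} → Adj pendant v w → Adj H (F v) (F w)
      F-hom {zero}  {w}     w∈ with refl ← tip-neighbour w∈ = symmetric H (proj₁ def)
      F-hom {suc v} {zero}  w∈ with refl ← adjacent-tip w∈ = proj₁ def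
      F-hom {suc v} {suc w} (there w∈) = homomorphism f w∈

      F-inj : ∀ v {a b} → Adj pendant v a → Adj pendant v b → F a ≡ F b → a ≡ b
      F-inj zero a∈ b∈ _ = trans (tip-neighbour a∈) (sym (tip-neighbour b∈))
      F-inj (suc v) {zero}  {zero}  _  _  _ = refl
      F-inj (suc v) {zero}  {suc b} a∈ (there b∈) eq with refl ← adjacent-tip a∈ =
        contradiction (sym eq) (proj₂ def b∈)
      F-inj (suc v) {suc a} {zero}  (there a∈) b∈ eq with refl ← adjacent-tip b∈ =
        contradiction eq (proj₂ def a∈)
      F-inj (suc v) {suc a} {suc b} (there a∈) (there b∈) eq =
        cong suc (locallyInjective f v a∈ b∈ eq)

    -- Placing the tip over `y` keeps the map injective around `u` because no neighbour of `u` lies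
    -- over `y` already.
    pendant-≤LI : pendant ≤LI H
    pendant-≤LI = record { map = F ; homomorphism = F-hom ; locallyInjective = F-inj }

    pendant-deficient : ∀ {v z} → (v ≡ u → z ≢ y) → Deficient f v z → Deficient pendant-≤LI (suc v) z
    pendant-deficient {v} {z} z≢y (z∈ , missed) = z∈ , missed′
      where
      missed′ : ∀ {x} → Adj pendant (suc v) x → F x ≢ z
      missed′ {zero}  x∈ eq = z≢y (adjacent-tip x∈) (sym eq)
      missed′ {suc x} (there x∈) = missed x∈

    tip-deficient : ∀ {z} → Adj H y z → z ≢ map f u → Deficient pendant-≤LI zero z
    tip-deficient z∈ z≢ = z∈ , λ x∈ eq → z≢ (trans (sym eq) (cong F (tip-neighbour x∈)))

-- Simple paths and closing them to cycles

record SimplePath (G : Graph) (u v : Vertex G) : Set where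
  field
    length   : ℕ
    vertex   : Fin (suc length) → Vertex G
    distinct : Injective _≡_ _≡_ vertex
    step     : ∀ (i : Fin length) → Adj G (vertex (inject₁ i)) (vertex (suc i))
    start    : vertex zero ≡ u
    end      : vertex (fromℕ length) ≡ v

module _ {G : Graph} where
  open SimplePath

  dropTo : ∀ {u v} (p : SimplePath G u v) i → SimplePath G (vertex p i) v
  dropTo p zero = record
    { length = length p ; vertex = vertex p ; distinct = distinct p ; step = step p
    ; start = refl ; end = end p }
  dropTo record { length = suc l ; vertex = vs ; distinct = d ; step = s ; end = e } (suc i) =
    dropTo record { length = l ; vertex = vs ∘ suc ; distinct = λ eq → suc-injective (d eq)
                  ; step = s ∘ suc ; start = refl ; end = e } i

  -- Loop erasure: if the new first vertex already occurs on the path, everything before that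
  -- occurrence is dropped.
  simplePath : ∀ {u v} → Star (Adj G) u v → SimplePath G u v
  simplePath {u} ε = record
    { length = 0 ; vertex = λ _ → u ; distinct = λ { {zero} {zero} _ → refl }
    ; step = λ () ; start = refl ; end = refl }
  simplePath {u} {v} (e ◅ walk) with simplePath walk
  ... | p with any? (λ i → vertex p i ≟ u)
  ... | yes (i , pᵢ≡u) = subst (λ w → SimplePath G w v) pᵢ≡u (dropTo p i)
  ... | no u∉p = record
    { length = suc (length p) ; vertex = vs ; distinct = inj
    ; step = stp ; start = refl ; end = end p }
    where
    vs : Fin (suc (suc (length p))) → Vertex G
    vs zero    = u
    vs (suc i) = vertex p i
    inj : Injective _≡_ _≡_ vs
    inj {zero}  {zero}  _  = refl
    inj {zero}  {suc j} eq = contradiction (j , sym eq) u∉p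
    inj {suc i} {zero}  eq = contradiction (i , eq) u∉p
    inj {suc i} {suc j} eq = cong suc (distinct p eq)
    stp : ∀ i → Adj G (vs (inject₁ i)) (vs (suc i))
    stp zero    = subst (Adj G u) (sym (start p)) e
    stp (suc i) = step p i

module AddEdge (X : Graph) (q t : Vertex X) where

  Edge : Vertex X → Vertex X → Set
  Edge v x = Adj X v x ⊎ (v ≡ q × x ≡ t) ⊎ (v ≡ t × x ≡ q)

  private
    edge? : Binary.Decidable Edge
    edge? v x = (x ∈? N X v) ⊎-dec ((v ≟ q) ×-dec (x ≟ t)) ⊎-dec ((v ≟ t) ×-dec (x ≟ q))

    edge-sym : ∀ {v x} → Edge v x → Edge x v
    edge-sym (inj₁ e)                = inj₁ (symmetric X e)
    edge-sym (inj₂ (inj₁ (v≡ , x≡))) = inj₂ (inj₂ (x≡ , v≡))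
    edge-sym (inj₂ (inj₂ (v≡ , x≡))) = inj₂ (inj₁ (x≡ , v≡))

  closed : Graph
  closed = record
    { order = order X ; nonEmpty = nonEmpty X ; N = λ v → ⟦ edge? v ⟧
    ; symmetric = λ {u} {v} e → ∈⟦⟧⁺ (edge? u) (edge-sym (∈⟦⟧⁻ (edge? v) e)) }

  edge⁺ : ∀ {v x} → Edge v x → Adj closed v x
  edge⁺ {v} = ∈⟦⟧⁺ (edge? v)

  edge⁻ : ∀ {v x} → Adj closed v x → Edge v x
  edge⁻ {v} = ∈⟦⟧⁻ (edge? v)

  closed-⊇ : X ≤LI closed
  closed-⊇ = record { map = id ; homomorphism = edge⁺ ∘ inj₁ ; locallyInjective = λ _ _ _ → id }

  closed-connected : Connected X → Connected closed
  closed-connected conn u v = Star.map (edge⁺ ∘ inj₁) (conn u v)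

  -- The new edge closes a simple path from `q` to `t`. The two hypotheses on `q` and `t` exclude
  -- paths of length zero and one, so at least three vertices remain.
  closed-cycle : Connected X → q ≢ t → ¬ Adj X q t → Σ[ c ∈ Cycle closed ] Cycle.vertex c zero ≡ q
  closed-cycle conn q≢t q≁t with simplePath {X} (conn q t)
  ... | record { length = 0 ; start = refl ; end = refl } = contradiction refl q≢t
  ... | record { length = 1 ; step = step ; start = refl ; end = refl } = contradiction (step zero) q≁t
  ... | record { length = suc (suc l) ; vertex = vertex ; distinct = distinct ; step = step
               ; start = start ; end = end } = record
    { last = suc (suc l) ; atLeast3 = s≤s (s≤s (s≤s z≤n)) ; vertex = vertex ; distinct = distinct
    ; step = edge⁺ ∘ inj₁ ∘ step ; close = edge⁺ (inj₂ (inj₂ (end , start))) } , start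

  module _ {H : Graph} (f : X ≤LI H)
    (defq : Deficient f q (map f t)) (deft : Deficient f t (map f q)) where

    private
      hom : ∀ {v x} → Edge v x → Adj H (map f v) (map f x)
      hom (inj₁ e)                    = homomorphism f e
      hom (inj₂ (inj₁ (refl , refl))) = proj₁ defq
      hom (inj₂ (inj₂ (refl , refl))) = proj₁ deft

      inj : ∀ {v a b} → Edge v a → Edge v b → map f a ≡ map f b → a ≡ b
      inj (inj₁ d) (inj₁ e) eq = locallyInjective f _ d e eq
      inj (inj₁ d) (inj₂ (inj₁ (refl , refl))) eq = contradiction eq (proj₂ defq d)
      inj (inj₁ d) (inj₂ (inj₂ (refl , refl))) eq = contradiction eq (proj₂ deft d)
      inj (inj₂ (inj₁ (refl , refl))) (inj₁ e) eq = contradiction (sym eq) (proj₂ defq e)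
      inj (inj₂ (inj₂ (refl , refl))) (inj₁ e) eq = contradiction (sym eq) (proj₂ deft e)
      inj (inj₂ (inj₁ (_ , refl))) (inj₂ (inj₁ (_ , refl))) _ = refl
      inj (inj₂ (inj₂ (_ , refl))) (inj₂ (inj₂ (_ , refl))) _ = refl
      -- Here the vertex is both `q` and `t`, so the two ends coincide.
      inj (inj₂ (inj₁ (refl , refl))) (inj₂ (inj₂ (refl , refl))) _ = refl
      inj (inj₂ (inj₂ (refl , refl))) (inj₂ (inj₁ (refl , refl))) _ = refl

    -- Each end of the new edge misses the image of the other end, so the edge conflicts with no old
    -- neighbour.
    closed-≤LI : closed ≤LI H
    closed-≤LI = record
      { map = map f ; homomorphism = hom ∘ edge⁻
      ; locallyInjective = λ v a∈ b∈ → inj (edge⁻ a∈) (edge⁻ b∈) }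

    closed-deficient : ∀ {v y} → v ≢ t → (v ≡ q → y ≢ map f t) →
      Deficient f v y → Deficient closed-≤LI v y
    closed-deficient {v} {y} v≢t y≢ (y∈ , missed) = y∈ , missed′ ∘ edge⁻
      where
      missed′ : ∀ {x} → Edge v x → map f x ≢ y
      missed′ (inj₁ e) = missed e
      missed′ (inj₂ (inj₁ (refl , refl))) eq = y≢ refl (sym eq)
      missed′ (inj₂ (inj₂ (refl , _))) = contradiction refl v≢t

two-image : ∀ {X Y} (f : X ≤LI Y) → ∀ {v} → Two (N X v) → Two (N Y (map f v))
two-image f (x , y , x∈ , y∈ , x≢y) =
  _ , _ , homomorphism f x∈ , homomorphism f y∈ , λ eq → x≢y (locallyInjective f _ x∈ y∈ eq)

-- Non-backtracking walks

iterate-injective : {A : Set} {f : A → A} → Injective _≡_ _≡_ f → ∀ k {x y} →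
  iterate f x k ≡ iterate f y k → x ≡ y
iterate-injective inj zero    eq = eq
iterate-injective inj (suc k) eq = inj (iterate-injective inj k eq)

iterate-+ : {A : Set} (f : A → A) (x : A) (j k : ℕ) →
  iterate f x (j + k) ≡ iterate f (iterate f x j) k
iterate-+ f x zero    k = refl
iterate-+ f x (suc j) k = iterate-+ f (f x) j k

-- Two iterates coincide by the pigeonhole principle, `code` showing that `A` is finite; injectivity
-- of `f` cancels the earlier iterations.
recurrent : {A : Set} {code : A → Fin n} → Injective _≡_ _≡_ code →
  {f : A → A} → Injective _≡_ _≡_ f → ∀ x → ∃[ k ] iterate f x (suc k) ≡ x
recurrent {n} {code = code} code-inj {f} f-inj x
  with i , j , i<j , eq ← pigeonhole (ℕ.n<1+n n) (λ i → code (iterate f x (toℕ i))) =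
  d i j , iterate-injective f-inj (toℕ i) (begin
    iterate f (iterate f x (suc (d i j))) (toℕ i)   ≡⟨ iterate-+ f x (suc (d i j)) (toℕ i) ⟨
    iterate f x (suc (d i j) + toℕ i)               ≡⟨ cong (iterate f x) (split i j i<j) ⟩
    iterate f x (toℕ j)                             ≡⟨ code-inj eq ⟨
    iterate f x (toℕ i)                             ∎)
  where
  open ≡-Reasoning
  d : Fin (suc n) → Fin (suc n) → ℕ
  d i j = toℕ j ∸ suc (toℕ i)
  split : ∀ i j → toℕ i < toℕ j → suc (d i j) + toℕ i ≡ toℕ j
  split i j i<j = trans (sym (ℕ.+-suc (d i j) (toℕ i))) (ℕ.m∸n+n≡m i<j)

transpose-left : (i j : Fin n) → transpose i j i ≡ j
transpose-left i j rewrite dec-true (i ≟ i) refl = refl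

transpose-right : (i j : Fin n) → transpose i j j ≡ i
transpose-right i j with j ≟ i
... | yes j≡i = j≡i
... | no _ rewrite dec-true (j ≟ j) refl = refl

transpose-other : (i j : Fin n) {k : Fin n} → k ≢ i → k ≢ j → transpose i j k ≡ k
transpose-other i j {k} k≢i k≢j rewrite dec-false (k ≟ i) k≢i | dec-false (k ≟ j) k≢j = refl

transpose-injective : (i j : Fin n) → Injective _≡_ _≡_ (transpose i j)
transpose-injective i j eq =
  trans (sym (transpose-inverse j i)) (trans (cong (transpose j i) eq) (transpose-inverse j i))

-- The permutation is the identity off `P`, so that a further point can be spliced in by a
-- transposition.
record Derangement (P : Fin n → Set) (a c : Fin n) : Set where
  field
    σ         : Fin n → Fin n
    injective : Injective _≡_ _≡_ σ
    moves     : ∀ {x} → P x → P (σ x) × σ x ≢ x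
    fixes     : ∀ {x} → ¬ P x → σ x ≡ x
    sends     : σ a ≡ c

module _ {a c : Fin n} (a≢c : a ≢ c) where

  open DecMembership {A = Fin n} _≟_ using () renaming (_∈?_ to _∈ₗ?_)

  private
    M : List (Fin n) → List (Fin n)
    M L = L ++ a ∷ c ∷ []

    a∈M : ∀ L → a ∈ₗ M L
    a∈M L = ∈-++⁺ʳ L (here refl)

    c∈M : ∀ L → c ∈ₗ M L
    c∈M L = ∈-++⁺ʳ L (there (here refl))

  -- A new element x is inserted into the cycle of c, right after c.
  derange : ∀ L → Derangement (_∈ₗ M L) a c
  derange [] = record
    { σ         = transpose a c
    ; injective = transpose-injective a c
    ; moves     = λ
      { (here refl)         → there (here (transpose-left a c)) ,
                              λ eq → a≢c (sym (trans (sym (transpose-left a c)) eq))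
      ; (there (here refl)) → here (transpose-right a c) ,
                              λ eq → a≢c (trans (sym (transpose-right a c)) eq) }
    ; fixes = λ x∉ → transpose-other a c (λ eq → x∉ (here eq)) (λ eq → x∉ (there (here eq)))
    ; sends = transpose-left a c }
  derange (x ∷ L) with derange L | x ∈ₗ? M L
  ... | D | yes x∈ = record
    { σ = σ ; injective = injective
    ; moves = λ y∈ → let σy∈ , σy≢ = moves (back y∈) in there σy∈ , σy≢
    ; fixes = λ y∉ → fixes (y∉ ∘ there)
    ; sends = sends }
    where
    open Derangement D
    back : ∀ {y} → y ∈ₗ x ∷ M L → y ∈ₗ M L
    back (here refl) = x∈
    back (there y∈)  = y∈
  ... | D | no x∉ = record
    { σ = τ ; injective = transpose-injective c x ∘ injective
    ; moves = mov ; fixes = fix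
    ; sends = trans (cong σ (transpose-other c x a≢c (λ { refl → x∉ (a∈M L) }))) sends }
    where
    open Derangement D
    τ = σ ∘ transpose c x
    τx : τ x ≡ σ c
    τx = cong σ (transpose-right c x)
    τc : τ c ≡ x
    τc = trans (cong σ (transpose-left c x)) (fixes x∉)
    moved : ∀ {y z} → τ y ≡ z → z ∈ₗ x ∷ M L → z ≢ y → τ y ∈ₗ x ∷ M L × τ y ≢ y
    moved refl z∈ z≢y = z∈ , z≢y
    mov : ∀ {y} → y ∈ₗ x ∷ M L → τ y ∈ₗ x ∷ M L × τ y ≢ y
    mov (here refl) = moved τx (there (proj₁ (moves (c∈M L))))
      (λ eq → x∉ (subst (_∈ₗ M L) eq (proj₁ (moves (c∈M L)))))
    mov {y} (there y∈) = by-cases (y ≟ c)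
      where
      y≢x : y ≢ x
      y≢x refl = x∉ y∈
      by-cases : Dec (y ≡ c) → τ y ∈ₗ x ∷ M L × τ y ≢ y
      by-cases (yes refl) = moved τc (here refl) (y≢x ∘ sym)
      by-cases (no y≢c)   = moved (cong σ (transpose-other c x y≢c y≢x))
        (there (proj₁ (moves y∈))) (proj₂ (moves y∈))
    fix : ∀ {y} → ¬ y ∈ₗ x ∷ M L → τ y ≡ y
    fix y∉ = trans (cong σ (transpose-other c x (λ { refl → y∉ (there (c∈M L)) }) (y∉ ∘ here)))
                   (fixes (y∉ ∘ there))

derangement : (p : Subset n) {a c : Fin n} → a ∈ p → c ∈ p → a ≢ c → Derangement (_∈ p) a c
derangement {n} p {a} {c} a∈ c∈ a≢c = record
  { σ = σ ; injective = injective ; sends = sends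
  ; moves = λ x∈ → let σx∈ , σx≢ = moves (to x∈) in from σx∈ , σx≢
  ; fixes = λ x∉ → fixes (x∉ ∘ from) }
  where
  L : List (Fin n)
  L = filter (_∈? p) (allFin n)
  open Derangement (derange a≢c L)
  to : ∀ {x} → x ∈ p → x ∈ₗ L ++ a ∷ c ∷ []
  to {x} x∈ = ∈-++⁺ˡ (∈-filter⁺ (_∈? p) (∈-allFin x) x∈)
  from : ∀ {x} → x ∈ₗ L ++ a ∷ c ∷ [] → x ∈ p
  from x∈ with ∈-++⁻ L x∈
  ... | inj₁ x∈L                 = proj₂ (∈-filter⁻ (_∈? p) {xs = allFin n} x∈L)
  ... | inj₂ (here refl)         = a∈
  ... | inj₂ (there (here refl)) = c∈

module NonBacktracking (H : Graph) (two : ∀ v → Two (N H v)) where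

  infix 4 _⟶_ _⇝_

  data _⟶_ : Vertex H × Vertex H → Vertex H × Vertex H → Set where
    turn : ∀ {a b c} → Adj H b c → c ≢ a → (a , b) ⟶ (b , c)

  _⇝_ : Vertex H × Vertex H → Vertex H × Vertex H → Set
  _⇝_ = Star _⟶_

  -- A derangement of every neighbourhood turns the oriented edges into a
  -- permutation, along whose cycles every non-backtracking walk can be undone.
  turn-back : ∀ {a b c} → Adj H b a → Adj H b c → a ≢ c → (b , c) ⇝ (a , b)
  turn-back {a} {b} {c} a∈ c∈ a≢c =
    -- The orbit of `(a , b)` under `ρ` returns after `suc k` steps. Its first step leads to
    -- `(b , c)`, so the other `k` lead from there back to `(a , b)`.
    let k , eq = recurrent combine-inj ρ-injective (a , b) in
    subst₂ _⇝_ (cong (b ,_) σb-sends) eq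
      (walk k (proj₁ (proj₂ (proj₂ (rotation b)) a∈)) )
    where
    Rotation : Vertex H → Set
    Rotation v = Σ[ σ ∈ (Vertex H → Vertex H) ]
      Injective _≡_ _≡_ σ × (∀ {x} → x ∈ N H v → σ x ∈ N H v × σ x ≢ x)
    rotation : ∀ v → Rotation v
    -- Only at `b` is a value prescribed; elsewhere any derangement will do, and two neighbours
    -- suffice for one.
    rotation v with v ≟ b
    ... | yes refl = σ , injective , moves
      where open Derangement (derangement (N H b) a∈ c∈ a≢c)
    ... | no _ with x , y , x∈ , y∈ , x≢y ← two v = σ , injective , moves
      where open Derangement (derangement (N H v) x∈ y∈ x≢y)
    σb-sends : proj₁ (rotation b) a ≡ c
    σb-sends with b ≟ b
    ... | yes refl = Derangement.sends (derangement (N H b) a∈ c∈ a≢c)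
    ... | no b≢b   = contradiction refl b≢b
    ρ : Vertex H × Vertex H → Vertex H × Vertex H
    ρ (u , v) = v , proj₁ (rotation v) u
    ρ-injective : Injective _≡_ _≡_ ρ
    ρ-injective {u , v} {u′ , v′} eq with refl ← cong proj₁ eq =
      cong (_, v) (proj₁ (proj₂ (rotation v)) (cong proj₂ eq))
    combine-inj : Injective _≡_ _≡_ (λ ((u , v) : Vertex H × Vertex H) → combine u v)
    combine-inj {u , v} {u′ , v′} eq = let p , q = combine-injective u v u′ v′ eq in cong₂ _,_ p q
    walk : ∀ k {u v} → Adj H u v → (u , v) ⇝ iterate ρ (u , v) k
    walk zero    e = ε
    walk (suc k) {u} {v} e = let σu∈ , σu≢ = proj₂ (proj₂ (rotation v)) (symmetric H e) in
      turn σu∈ σu≢ ◅ walk k σu∈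

  ⇝-adjacent : ∀ {a b a′ b′} → Adj H a b → (a , b) ⇝ (a′ , b′) → Adj H a′ b′
  ⇝-adjacent ab ε                = ab
  ⇝-adjacent ab (turn bc _ ◅ w) = ⇝-adjacent bc w

  -- Each single step is undone by `turn-back`, so reachability between oriented edges is symmetric.
  ⇝-reverse : ∀ {a b a′ b′} → Adj H a b → (a , b) ⇝ (a′ , b′) → (a′ , b′) ⇝ (a , b)
  ⇝-reverse ab ε                  = ε
  ⇝-reverse ab (turn bc c≢a ◅ w) =
    ⇝-reverse bc w ◅◅ turn-back (symmetric H ab) bc (c≢a ∘ sym)

  module _ (conn : Connected H) {c : Vertex H} (hub-neighbours : Three (N H c)) where

    private
      open Three hub-neighbours using (x; x∈)

      hub : Vertex H × Vertex H
      hub = x , c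

      Good : Vertex H → Set
      Good v = ∀ {a} → Adj H v a → ((a , v) ⇝ hub) × ((v , a) ⇝ hub)

      avoiding : ∀ a → ∃[ b ] Adj H c b × b ≢ a × b ≢ x
      avoiding = three-avoid hub-neighbours

      -- A neighbour `b` of `c` other than `a` and `x` is a possible continuation of both `(a , c)`
      -- and `(x , c)`: go on to `(c , b)`, then undo the step from `(x , c)`.
      into-hub : ∀ {a} → Adj H c a → (a , c) ⇝ hub
      into-hub {a} a∈ with b , b∈ , b≢a , b≢x ← avoiding a =
        turn b∈ b≢a ◅ turn-back x∈ b∈ (b≢x ∘ sym)

      good-hub : Good c
      good-hub {a} a∈ with b , b∈ , b≢a , b≢x ← avoiding a =
        into-hub a∈ , (turn-back b∈ a∈ b≢a ◅◅ into-hub b∈)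

      -- An edge at `w` is either the edge to `v`, or it is linked to that edge by one turn at `w`,
      -- taken forwards or undone.
      good-step : ∀ {v w} → Adj H v w → Good v → Good w
      good-step {v} {w} vw good {a} a∈ with a ≟ v
      ... | yes refl = proj₂ (good vw) , proj₁ (good vw)
      ... | no a≢v =
        turn (symmetric H vw) (a≢v ∘ sym) ◅ proj₁ (good vw) ,
        turn-back (symmetric H vw) a∈ (a≢v ∘ sym) ◅◅ proj₂ (good vw)

      good : ∀ {v} → Star (Adj H) c v → Good v
      good = go good-hub
        where
        go : ∀ {u v} → Good u → Star (Adj H) u v → Good v
        go g ε       = g
        go g (e ◅ p) = go (good-step e g) p

    reachable : ∀ {a b a′ b′} → Adj H a b → Adj H a′ b′ → (a , b) ⇝ (a′ , b′)
    reachable {a} {b} {a′} {b′} ab ab′ =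
      proj₂ (good (conn c a) ab) ◅◅ ⇝-reverse ab′ (proj₂ (good (conn c a′) ab′))

-- Prolonging a pendant path

neighbour⇒two : ∀ {G v w} → NoDegreeOne G → Adj G v w → Two (N G v)
neighbour⇒two {G} {v} no1 e = size⇒two (N G v) (ℕ.≤∧≢⇒< (nonempty⇒size>0 e) (no1 v ∘ sym))

two⇒noDegreeOne : ∀ {G} → (∀ v → Two (N G v)) → NoDegreeOne G
two⇒noDegreeOne two v deg≡1 = ℕ.<-irrefl (sym deg≡1) (two⇒size (two v))

-- Strictness is kept as `≺`, which implies both the strict order and the difference of matrices,
-- and passes to any graph below `G`.
record Between (G H : Graph) : Set where
  field
    F         : Graph
    connected : Connected F
    below     : G ≤LI F
    above     : F ≤LI H
    G≺F       : G ≺ F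
    F≺H       : F ≺ H
    noLeaf    : NoDegreeOne F
    hasCycle  : HasCycleWithDegreeAbove2 F

restrict : ∀ {G Y H} → G ≤LI Y → Between Y H → Between G H
restrict G≤Y B = record
  { F = F ; connected = connected ; below = ≤LI-trans G≤Y below ; above = above
  ; G≺F = ≤LI-≺-trans G≤Y G≺F ; F≺H = F≺H ; noLeaf = noLeaf ; hasCycle = hasCycle }
  where open Between B

module Stems (H : Graph) where

  -- A graph over H with a pendant vertex tip; the image of (base , tip) is the
  -- oriented edge from which a non-backtracking walk in H can be continued.
  record Stem : Set where
    field
      graph     : Graph
      proj      : graph ≤LI H
      connected : Connected graph
      base tip  : Vertex graph
      base∈     : Adj graph tip base
      only-base : ∀ {x} → Adj graph tip x → x ≡ base

    image : Vertex graph → Vertex H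
    image = map proj

    image-adjacent : Adj H (image base) (image tip)
    image-adjacent = homomorphism proj (symmetric graph base∈)

    tip-def : ∀ {y} → Adj H (image tip) y → y ≢ image base → Deficient proj tip y
    tip-def y∈ y≢ = y∈ , λ x∈ eq → y≢ (trans (sym eq) (cong image (only-base x∈)))

  open Stem

  infix 4 _⊑_

  -- Growth changes the neighbourhood of no old vertex but the tip, so deficiencies elsewhere
  -- persist. `vertices` later shows that no leaf is left besides the tip.
  record _⊑_ (S S′ : Stem) : Set where
    field
      incl      : graph S ≤LI graph S′
      injective : Injective _≡_ _≡_ (map incl)
      over      : ∀ v → image S′ (map incl v) ≡ image S v
      inner     : ∀ {v} → v ≢ tip S → map incl v ≢ tip S′
      deficient : ∀ {v y} → v ≢ tip S → Deficient (proj S) v y → Deficient (proj S′) (map incl v) y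
      vertices  : ∀ {w} → w ≢ tip S′ →
                  Two (N (graph S′) w) ⊎ (∃[ v ] v ≢ tip S × map incl v ≡ w)

  open _⊑_

  ⊑-refl : ∀ {S} → S ⊑ S
  ⊑-refl = record
    { incl = ≤LI-refl ; injective = id ; over = λ _ → refl ; inner = id ; deficient = λ _ → id
    ; vertices = λ {w} w≢ → inj₂ (w , w≢ , refl) }

  ⊑-trans : ∀ {S T U} → S ⊑ T → T ⊑ U → S ⊑ U
  ⊑-trans {S} {T} {U} a b = record
    { incl      = ≤LI-trans (incl a) (incl b)
    ; injective = injective a ∘ injective b
    ; over      = λ v → trans (over b _) (over a v)
    ; inner     = inner b ∘ inner a
    ; deficient = λ v≢ → deficient b (inner a v≢) ∘ deficient a v≢
    ; vertices  = vert
    }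
    where
    vert : ∀ {w} → w ≢ tip U →
      Two (N (graph U) w) ⊎ (∃[ v ] v ≢ tip S × map (incl b) (map (incl a) v) ≡ w)
    vert w≢ with vertices b w≢
    ... | inj₁ two = inj₁ two
    ... | inj₂ (v , v≢ , refl) with vertices a v≢
    ... | inj₁ two = inj₁ (two-image (incl b) two)
    ... | inj₂ (u , u≢ , refl) = inj₂ (u , u≢ , refl)

  sprout : ∀ {X} (f : X ≤LI H) → Connected X → ∀ {u y} → Deficient f u y → Stem
  sprout {X} f conn {u} def = record
    { graph     = pendant X u
    ; proj      = pendant-≤LI X u f def
    ; connected = pendant-connected X u conn
    ; base      = suc u
    ; tip       = zero
    ; base∈     = symmetric (pendant X u) {zero} {suc u} (tip-adjacent X u)
    ; only-base = tip-neighbour X u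
    }

  grow : (S : Stem) → ∀ {y} → Adj H (image S (tip S)) y → y ≢ image S (base S) → Stem
  grow S y∈ y≢ = sprout (proj S) (connected S) (tip-def S y∈ y≢)

  ⊑-grow : (S : Stem) → ∀ {y} (y∈ : Adj H (image S (tip S)) y) (y≢ : y ≢ image S (base S)) →
    S ⊑ grow S y∈ y≢
  ⊑-grow S y∈ y≢ = record
    { incl      = pendant-⊇ (graph S) (tip S)
    ; injective = suc-injective
    ; over      = λ _ → refl
    ; inner     = λ _ ()
    ; deficient = λ v≢ → pendant-deficient (graph S) (tip S) (proj S) (tip-def S y∈ y≢)
                           (λ v≡ → contradiction v≡ v≢)
    ; vertices  = vert
    }
    where
    vert : ∀ {w} → w ≢ zero →
      Two (N (pendant (graph S) (tip S)) w) ⊎ (∃[ v ] v ≢ tip S × suc v ≡ w)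
    vert {zero}  w≢ = contradiction refl w≢
    vert {suc v} _ with v ≟ tip S
    ... | no v≢    = inj₂ (v , v≢ , refl)
    -- The old tip now lies between the new tip and its former base.
    ... | yes refl = inj₁ (zero , suc (base S) , here , there (base∈ S) , λ ())

  grow-tip-deficient : (S : Stem) → ∀ {y z} (y∈ : Adj H (image S (tip S)) y) (y≢ : y ≢ image S (base S)) →
    Adj H (image S (tip S)) z → z ≢ image S (base S) → z ≢ y →
    Deficient (proj (grow S y∈ y≢)) (suc (tip S)) z
  grow-tip-deficient S y∈ y≢ z∈ z≢ z≢y =
    pendant-deficient (graph S) (tip S) (proj S) (tip-def S y∈ y≢) (λ _ → z≢y) (tip-def S z∈ z≢)

  record Extension (S : Stem) (a b : Vertex H) : Set where
    field
      stem     : Stem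
      extends  : S ⊑ stem
      at-base  : image stem (base stem) ≡ a
      at-tip   : image stem (tip stem) ≡ b

  -- After closing, the tip is adjacent to both `base S` and `q`, so these need distinct images.
  module Closing (S : Stem) {q : Vertex (graph S)} (q≢tip : q ≢ tip S)
    (defq : Deficient (proj S) q (image S (tip S))) (base≢q : image S (base S) ≢ image S q) where

    open AddEdge (graph S) q (tip S) public

    private
      deft : Deficient (proj S) (tip S) (image S q)
      deft = tip-def S (symmetric H (proj₁ defq)) (base≢q ∘ sym)

      q≁tip : ¬ Adj (graph S) q (tip S)
      q≁tip e = proj₂ defq e refl

    over-H : closed ≤LI H
    over-H = closed-≤LI (proj S) defq deft

    connected-closed : Connected closed
    connected-closed = closed-connected (connected S)

    remains-deficient : ∀ {v y} → v ≢ tip S → (v ≡ q → y ≢ image S (tip S)) →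
      Deficient (proj S) v y → Deficient over-H v y
    remains-deficient = closed-deficient (proj S) defq deft

    -- Closing adds a neighbour to `q`, so one earlier neighbour `a` suffices there. This admits
    -- stems that sprout from a single vertex.
    all-two : ∀ {a} → Adj (graph S) q a → (∀ {v} → v ≢ tip S → v ≢ q → Two (N (graph S) v)) →
      ∀ v → Two (N closed v)
    all-two {a} qa two v = by-cases (v ≟ tip S) (v ≟ q)
      where
      by-cases : ∀ {v} → Dec (v ≡ tip S) → Dec (v ≡ q) → Two (N closed v)
      by-cases (yes refl) _ =
        base S , q , edge⁺ (inj₁ (base∈ S)) , edge⁺ (inj₂ (inj₂ (refl , refl))) ,
        λ eq → base≢q (cong (image S) eq)
      by-cases (no _) (yes refl) =
        a , tip S , edge⁺ (inj₁ qa) , edge⁺ (inj₂ (inj₁ (refl , refl))) , λ { refl → q≁tip qa }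
      by-cases (no v≢tip) (no v≢q) = two-image closed-⊇ (two v≢tip v≢q)

    cycle : Two (N (graph S) q) → HasCycleWithDegreeAbove2 closed
    cycle (a , b , a∈ , b∈ , a≢b) with c , c₀≡q ← closed-cycle (connected S) q≢tip q≁tip =
      c , zero , subst (λ v → 2 < degree closed v) (sym c₀≡q) (three⇒size
        (three (edge⁺ (inj₁ a∈)) (edge⁺ (inj₁ b∈)) (edge⁺ (inj₂ (inj₁ (refl , refl))))
               a≢b (λ { refl → q≁tip a∈ }) (λ { refl → q≁tip b∈ })))

  module _ (conn : Connected H) (two : ∀ v → Two (N H v)) where

    open NonBacktracking H two

    extend-along : ∀ S {a b} → (image S (base S) , image S (tip S)) ⇝ (a , b) → Extension S a b
    extend-along S ε = record { stem = S ; extends = ⊑-refl ; at-base = refl ; at-tip = refl }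
    extend-along S (turn y∈ y≢ ◅ w) = record
      { stem = stem ; extends = ⊑-trans (⊑-grow S y∈ y≢) extends ; at-base = at-base ; at-tip = at-tip }
      where open Extension (extend-along (grow S y∈ y≢) w)

    module _ {c : Vertex H} (hub-neighbours : Three (N H c)) where

      open Three hub-neighbours

      abstract
        extend-to : ∀ S {a b} → Adj H a b → Extension S a b
        extend-to S ab = extend-along S (reachable conn hub-neighbours (image-adjacent S) ab)

      -- A vertex over c that keeps the two neighbours over x and y.
      record Passage (S : Stem) : Set where
        field
          stem    : Stem
          extends : S ⊑ stem
          over-c  : Vertex (graph stem)
          inner-c : over-c ≢ tip stem
          image-c : image stem over-c ≡ c
          two-c   : Two (N (graph stem) over-c)
          def-z   : Deficient (proj stem) over-c z
          new-c   : ∀ {v} → v ≢ tip S → map (incl extends) v ≢ over-c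

      abstract
        passage : ∀ S → Passage S
        -- The stem is led to an edge over `(x , c)` and then grown towards `y`; its former tip is
        -- the required vertex over `c`.
        passage S with extend-to S (symmetric H x∈)
        ... | record { stem = T ; extends = S⊑T ; at-base = refl ; at-tip = refl } = record
          { stem    = grow T y∈ (x≢y ∘ sym)
          ; extends = ⊑-trans S⊑T (⊑-grow T y∈ (x≢y ∘ sym))
          ; over-c  = suc (tip T)
          ; inner-c = λ ()
          ; image-c = refl
          ; two-c   = zero , suc (base T) , tip-adjacent (graph T) (tip T) , there (base∈ T) , λ ()
          ; def-z   = grow-tip-deficient T y∈ (x≢y ∘ sym) z∈ (x≢z ∘ sym) (y≢z ∘ sym)
          ; new-c   = λ v≢ eq → inner S⊑T v≢ (suc-injective eq)
          }

      lollipop : ∀ {G} (f : G ≤LI H) → Connected G → (∀ v → Two (N G v)) →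
        ∀ {u y} → Deficient f u y → Between G H
      lollipop {G} f connG twoG {u} {y₀} def = record
        { F         = closed
        ; connected = connected-closed
        ; below     = ≤LI-trans (pendant-⊇ G u) P≤F
        ; above     = over-H
        ; G≺F       = ≺-≤LI-trans (deficient⇒≺ (pendant-⊇ G u) connG (connected S) (pendant-⊇-deficient G u)) P≤F
        -- The new edge fills the place over `z` at `q` only. By `new-c` the first passage `d` is
        -- another vertex and still misses `z`.
        ; F≺H       = deficient⇒≺ over-H connected-closed conn
                        (remains-deficient (inner S₂⊑S₃ (inner Q.extends P.inner-c))
                          (λ eq → contradiction (injective S₂⊑S₃ eq) (Q.new-c P.inner-c)) d-def)
        ; noLeaf    = two⇒noDegreeOne {closed} (all-two (proj₁ (proj₂ (proj₂ q-two)))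
                        (λ v≢tip _ → stem-two v≢tip))
        ; hasCycle  = cycle q-two
        }
        where
        S : Stem
        S = sprout f connG def
        module P = Passage (passage S)
        module Q = Passage (passage P.stem)
        -- The stem must reach `z` from a vertex other than `c`, since the closing edge goes on from
        -- `z` to `c`.
        w-data = two-avoid (two z) c
        module R = Extension (extend-to Q.stem (symmetric H (proj₁ (proj₂ w-data))))
        S₂⊑S₃ = R.extends
        q d : Vertex (graph R.stem)
        q = map (incl S₂⊑S₃) Q.over-c
        d = map (incl S₂⊑S₃) (map (incl Q.extends) P.over-c)
        d-def : Deficient (proj R.stem) d z
        d-def = deficient S₂⊑S₃ (inner Q.extends P.inner-c) (deficient Q.extends P.inner-c P.def-z)
        q-two : Two (N (graph R.stem) q)
        q-two = two-image (incl S₂⊑S₃) Q.two-c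
        image-q : image R.stem q ≡ c
        image-q = trans (over S₂⊑S₃ _) Q.image-c
        S⊑S₃ : S ⊑ R.stem
        S⊑S₃ = ⊑-trans P.extends (⊑-trans Q.extends S₂⊑S₃)
        open Closing R.stem {q} (inner S₂⊑S₃ Q.inner-c)
          (subst (Deficient (proj R.stem) q) (sym R.at-tip) (deficient S₂⊑S₃ Q.inner-c Q.def-z))
          (λ eq → proj₂ (proj₂ w-data) (trans (sym R.at-base) (trans eq image-q)))
        P≤F : pendant G u ≤LI closed
        P≤F = ≤LI-trans (incl S⊑S₃) closed-⊇
        stem-two : ∀ {v} → v ≢ tip R.stem → Two (N (graph R.stem) v)
        stem-two v≢ with vertices S⊑S₃ v≢
        ... | inj₁ t = t
        ... | inj₂ (zero  , v≢0 , _)    = contradiction refl v≢0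
        ... | inj₂ (suc v , _   , refl) = two-image (≤LI-trans (pendant-⊇ G u) (incl S⊑S₃)) (twoG v)

      -- A stem leaves `u` towards `x`, comes back to `y` and is joined to `u`. The resulting graph
      -- has no leaf and still misses `z` at `u`, so `lollipop` applies to it.
      lollipop-point : ∀ {G} (f : G ≤LI H) → Connected G → ∀ {u} → (∀ v → v ≡ u) →
        Deficient f u x → Deficient f u y → Deficient f u z → Between G H
      lollipop-point {G} f connG {u} point def-x def-y def-z =
        restrict G≤Y (lollipop over-H connected-closed Y-two Y-deficient)
        where
        S : Stem
        S = sprout f connG def-x
        -- Again the last stem edge must not come from the vertex to which the closing edge leads.
        w-data = two-avoid (two y) (map f u)
        module R = Extension (extend-to S (symmetric H (proj₁ (proj₂ w-data))))
        q : Vertex (graph R.stem)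
        q = map (incl R.extends) (suc u)
        q-def : ∀ {a} → a ≢ x → Deficient f u a → Deficient (proj R.stem) q a
        q-def a≢x def = deficient R.extends (λ ()) (pendant-deficient G u f def-x (λ _ → a≢x) def)
        q≢tip : q ≢ tip R.stem
        q≢tip = inner R.extends (λ ())
        open Closing R.stem {q} q≢tip
          (subst (Deficient (proj R.stem) q) (sym R.at-tip) (q-def (x≢y ∘ sym) def-y))
          (λ eq → proj₂ (proj₂ w-data) (trans (sym R.at-base) (trans eq (over R.extends (suc u)))))
        G≤Y : G ≤LI closed
        G≤Y = ≤LI-trans (pendant-⊇ G u) (≤LI-trans (incl R.extends) closed-⊇)
        stem-two : ∀ {v} → v ≢ tip R.stem → v ≢ q → Two (N (graph R.stem) v)
        stem-two v≢ v≢q with vertices R.extends v≢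
        ... | inj₁ t = t
        ... | inj₂ (zero  , v≢0 , _)    = contradiction refl v≢0
        ... | inj₂ (suc v , _   , refl) =
          contradiction (cong (map (incl R.extends) ∘ suc) (point v)) v≢q
        Y-two : ∀ v → Two (N closed v)
        Y-two = all-two (homomorphism (incl R.extends) (tip-adjacent G u)) stem-two
        Y-deficient : Deficient over-H q z
        Y-deficient = remains-deficient q≢tip (λ _ eq → y≢z (sym (trans eq R.at-tip)))
          (q-def (x≢z ∘ sym) def-z)

-- The intermediate graphs for (a) and (b)

strictly-below : ∀ {G H} → G ≤LI H → G ≺ H → G <LI H
strictly-below f lt = f , ≺⇒≰LI lt

module _ {G H : Graph} (connG : Connected G) (connH : Connected H) (two : ∀ v → Two (N H v))
  (f : G ≤LI H) {u : Vertex G} {y : Vertex H} (def : Deficient f u y) where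

  leaf-between : ∃[ F ] (Connected F × G <LI F × F <LI H × ¬ (F ≈drm G) × ¬ (F ≈drm H))
  leaf-between = pendant G u , connF , strictly-below (pendant-⊇ G u) G≺F , strictly-below F≤H F≺H ,
    proj₂ (≺⇒≉drm G≺F) , proj₁ (≺⇒≉drm F≺H)
    where
    connF : Connected (pendant G u)
    connF = pendant-connected G u connG
    F≤H : pendant G u ≤LI H
    F≤H = pendant-≤LI G u f def
    G≺F : G ≺ pendant G u
    G≺F = deficient⇒≺ (pendant-⊇ G u) connG connF (pendant-⊇-deficient G u)
    F≺H : pendant G u ≺ H
    -- The tip has degree one, whereas `y` has a second neighbour `z` in `H`, which the tip misses.
    F≺H with z , z∈ , z≢ ← two-avoid (two y) (map f u) =
      deficient⇒≺ F≤H connF connH {zero} (tip-deficient G u f def z∈ z≢)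

  cyclic-between : NoDegreeOne G → ∀ {c} → Three (N H c) → Between G H
  cyclic-between no1G {c} t@(three x∈ y∈ z∈ _ _ _) with nonempty? (N G u)
  ... | yes (_ , e) = Stems.lollipop H connH two t f connG
    (λ v → neighbour⇒two {G} no1G (proj₂ (connected⇒neighbour G connG e v))) def
  ... | no none = Stems.lollipop-point H connH two t const-c connG point
    (missing x∈) (missing y∈) (missing z∈)
    where
    point : ∀ v → v ≡ u
    point v with connG u v
    ... | ε     = refl
    ... | e ◅ _ = contradiction (_ , e) none
    no-edge : ∀ {v w} → ¬ Adj G v w
    no-edge {v} {w} e = none (w , subst (λ v → Adj G v w) (point v) e)
    -- As `G` has no edge, its vertex may be placed over `c` instead of its image under `f`, and
    -- then misses every neighbour of `c`.
    const-c : G ≤LI H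
    const-c = record
      { map              = λ _ → c
      ; homomorphism     = λ e → contradiction e no-edge
      ; locallyInjective = λ _ e → contradiction e no-edge }
    missing : ∀ {a} → Adj H c a → Deficient const-c u a
    missing a∈ = a∈ , λ e → contradiction e no-edge

between : ∀ {G H} → Between G H → ∃[ F ] (Connected F × G <LI F × F <LI H × ¬ (F ≈drm G) × ¬ (F ≈drm H)
    × NoDegreeOne F × HasCycleWithDegreeAbove2 F)
between B = F , connected , strictly-below below G≺F , strictly-below above F≺H ,
  proj₂ (≺⇒≉drm G≺F) , proj₁ (≺⇒≉drm F≺H) , noLeaf , hasCycle
  where open Between B

theorem5p7p12 : ∀ (G H : Graph) → Connected G → Connected H →
    ¬ (G ≈drm H) → G ≤LI H → NoDegreeOne H →
    (∃[ F ] (Connected F × G <LI F × F <LI H × ¬ (F ≈drm G) × ¬ (F ≈drm H)))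
    ×
    (NoDegreeOne G → HasCycleWithDegreeAbove2 H →
    ∃[ F ] (Connected F × G <LI F × F <LI H × ¬ (F ≈drm G) × ¬ (F ≈drm H)
    × NoDegreeOne F × HasCycleWithDegreeAbove2 F))
theorem5p7p12 G H connG connH G≉H f no1H with ≉drm⇒deficient connH G≉H f
... | u , y , def = leaf-between connG connH two f def ,
  λ { no1G (cyc , i , deg>2) →
    between (cyclic-between connG connH two f def no1G (size⇒three (N H (Cycle.vertex cyc i)) deg>2)) }
  where
  -- The missed neighbour provides an edge of `H`, so by connectedness no vertex is isolated, and
  -- degree one is excluded by hypothesis.
  two : ∀ v → Two (N H v)
  two v = neighbour⇒two {H} no1H (proj₂ (connected⇒neighbour H connH (proj₁ def) v))
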